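{- Let $K_4^{(3)- }$ denote the $3$-graph on $4$ vertices with exactly $3$ edges. For an integer $n\ge 3$ let \[d_{\star}=d_\star(n)=\frac{1}{6}\left(\sqrt{13n^2-72n+108}-n+6\right).\] Then for every odd integer $n$, \[\frac{n-1}{2}\lfloor d_{\star}\rfloor\le c_1(n,K_4^{(3)- })\le \left\lfloor \frac{n-1}{2}d_{\star}\right\rfloor.\] In particular, $c_1(K_4^{(3)- })=\frac{\sqrt{13}-1}{6}$.
   Context: A $3$-graph is a $3$-uniform hypergraph. For a $3$-graph $G$ and a vertex $v$, $\deg(v)$ is the number of edges containing $v$, and the minimum vertex degree is $\delta_1(G)=\min_v \deg(v)$. For a $3$-graph $F$, a $3$-graph $G$ has an $F$-covering if every vertex of $G$ is contained in a copy of $F$ (a subhypergraph isomorphic to $F$) in $G$. The $1$-degree covering threshold is $c_1(n,F)=\max\{\delta_1(G): v(G)=n,\ G \text{ has no } F\text{ -covering}\}$, and the $1$-degree covering density is $c_1(F)=\lim_{n\to\infty} c_1(n,F)/\binom{n-1}{2}$. -}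

module Defs where

open import Data.Bool using (Bool; true; false; _∧_; _∨_; not)
open import Data.Nat using (ℕ; zero; suc; _≤_; _<ᵇ_; _≡ᵇ_)
open import Data.Nat.Combinatorics using (_C_)
open import Data.Fin using (Fin; zero; suc; toℕ)
open import Data.List using (List; length; filterᵇ; cartesianProduct; allFin)
open import Data.Product using (Σ; ∃; ∃-syntax; _×_; _,_; proj₁; proj₂)
open import Data.Sum using (_⊎_)
open import Data.Integer as ℤ using (ℤ; +_)
open import Function.Definitions using (Injective)
open import Relation.Binary.PropositionalEquality using (_≡_; refl)
open import Relation.Nullary using (¬_)

record ThreeGraph (n : ℕ) : Set where
  field
    edge  : Fin n → Fin n → Fin n → Bool
    sym₁₂ : ∀ x y z → edge x y z ≡ edge y x z
    sym₂₃ : ∀ x y z → edge x y z ≡ edge x z y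
    irr   : ∀ x z → edge x x z ≡ false

open ThreeGraph public

count : {A : Set} → (A → Bool) → List A → ℕ
count p xs = length (filterᵇ p xs)

deg : {n : ℕ} → ThreeGraph n → Fin n → ℕ
deg {n} G v =
  count (λ jk → (toℕ (proj₁ jk) <ᵇ toℕ (proj₂ jk)) ∧ edge G v (proj₁ jk) (proj₂ jk))
        (cartesianProduct (allFin n) (allFin n))

MinDegIs : {n : ℕ} → ThreeGraph n → ℕ → Set
MinDegIs G d = (∀ v → d ≤ deg G v) × (∃[ v ] deg G v ≡ d)

CopyContaining : {k n : ℕ} → ThreeGraph k → ThreeGraph n → Fin n → Set
CopyContaining {k} {n} F G v =
  Σ (Fin k → Fin n) λ φ →
    Injective _≡_ _≡_ φ
    × (∀ x y z → edge F x y z ≡ true → edge G (φ x) (φ y) (φ z) ≡ true)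
    × (∃[ i ] φ i ≡ v)

HasCovering : {k n : ℕ} → ThreeGraph k → ThreeGraph n → Set
HasCovering F G = ∀ v → CopyContaining F G v

IsC1 : (n : ℕ) → {k : ℕ} → ThreeGraph k → ℕ → Set
IsC1 n F c =
  (Σ (ThreeGraph n) λ G → ¬ HasCovering F G × MinDegIs G c)
  × (∀ (G : ThreeGraph n) d → ¬ HasCovering F G → MinDegIs G d → d ≤ c)

-- K₄^(3)- : vertices 0,1,2,3, edges {0,1,2}, {0,1,3}, {0,2,3}
-- (every 3-set containing 0; the only non-edge is {1,2,3}).

K4m-edge : Fin 4 → Fin 4 → Fin 4 → Bool
K4m-edge x y z =
  not (toℕ x ≡ᵇ toℕ y) ∧ not (toℕ y ≡ᵇ toℕ z) ∧ not (toℕ x ≡ᵇ toℕ z)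
  ∧ ((toℕ x ≡ᵇ 0) ∨ (toℕ y ≡ᵇ 0) ∨ (toℕ z ≡ᵇ 0))

K4m-sym₁₂ : ∀ x y z → K4m-edge x y z ≡ K4m-edge y x z
K4m-sym₁₂ zero zero zero = refl
K4m-sym₁₂ zero zero (suc zero) = refl
K4m-sym₁₂ zero zero (suc (suc zero)) = refl
K4m-sym₁₂ zero zero (suc (suc (suc zero))) = refl
K4m-sym₁₂ zero (suc zero) zero = refl
K4m-sym₁₂ zero (suc zero) (suc zero) = refl
K4m-sym₁₂ zero (suc zero) (suc (suc zero)) = refl
K4m-sym₁₂ zero (suc zero) (suc (suc (suc zero))) = refl
K4m-sym₁₂ zero (suc (suc zero)) zero = refl
K4m-sym₁₂ zero (suc (suc zero)) (suc zero) = refl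
K4m-sym₁₂ zero (suc (suc zero)) (suc (suc zero)) = refl
K4m-sym₁₂ zero (suc (suc zero)) (suc (suc (suc zero))) = refl
K4m-sym₁₂ zero (suc (suc (suc zero))) zero = refl
K4m-sym₁₂ zero (suc (suc (suc zero))) (suc zero) = refl
K4m-sym₁₂ zero (suc (suc (suc zero))) (suc (suc zero)) = refl
K4m-sym₁₂ zero (suc (suc (suc zero))) (suc (suc (suc zero))) = refl
K4m-sym₁₂ (suc zero) zero zero = refl
K4m-sym₁₂ (suc zero) zero (suc zero) = refl
K4m-sym₁₂ (suc zero) zero (suc (suc zero)) = refl
K4m-sym₁₂ (suc zero) zero (suc (suc (suc zero))) = refl
K4m-sym₁₂ (suc zero) (suc zero) zero = refl
K4m-sym₁₂ (suc zero) (suc zero) (suc zero) = refl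
K4m-sym₁₂ (suc zero) (suc zero) (suc (suc zero)) = refl
K4m-sym₁₂ (suc zero) (suc zero) (suc (suc (suc zero))) = refl
K4m-sym₁₂ (suc zero) (suc (suc zero)) zero = refl
K4m-sym₁₂ (suc zero) (suc (suc zero)) (suc zero) = refl
K4m-sym₁₂ (suc zero) (suc (suc zero)) (suc (suc zero)) = refl
K4m-sym₁₂ (suc zero) (suc (suc zero)) (suc (suc (suc zero))) = refl
K4m-sym₁₂ (suc zero) (suc (suc (suc zero))) zero = refl
K4m-sym₁₂ (suc zero) (suc (suc (suc zero))) (suc zero) = refl
K4m-sym₁₂ (suc zero) (suc (suc (suc zero))) (suc (suc zero)) = refl
K4m-sym₁₂ (suc zero) (suc (suc (suc zero))) (suc (suc (suc zero))) = refl
K4m-sym₁₂ (suc (suc zero)) zero zero = refl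
K4m-sym₁₂ (suc (suc zero)) zero (suc zero) = refl
K4m-sym₁₂ (suc (suc zero)) zero (suc (suc zero)) = refl
K4m-sym₁₂ (suc (suc zero)) zero (suc (suc (suc zero))) = refl
K4m-sym₁₂ (suc (suc zero)) (suc zero) zero = refl
K4m-sym₁₂ (suc (suc zero)) (suc zero) (suc zero) = refl
K4m-sym₁₂ (suc (suc zero)) (suc zero) (suc (suc zero)) = refl
K4m-sym₁₂ (suc (suc zero)) (suc zero) (suc (suc (suc zero))) = refl
K4m-sym₁₂ (suc (suc zero)) (suc (suc zero)) zero = refl
K4m-sym₁₂ (suc (suc zero)) (suc (suc zero)) (suc zero) = refl
K4m-sym₁₂ (suc (suc zero)) (suc (suc zero)) (suc (suc zero)) = refl
K4m-sym₁₂ (suc (suc zero)) (suc (suc zero)) (suc (suc (suc zero))) = refl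
K4m-sym₁₂ (suc (suc zero)) (suc (suc (suc zero))) zero = refl
K4m-sym₁₂ (suc (suc zero)) (suc (suc (suc zero))) (suc zero) = refl
K4m-sym₁₂ (suc (suc zero)) (suc (suc (suc zero))) (suc (suc zero)) = refl
K4m-sym₁₂ (suc (suc zero)) (suc (suc (suc zero))) (suc (suc (suc zero))) = refl
K4m-sym₁₂ (suc (suc (suc zero))) zero zero = refl
K4m-sym₁₂ (suc (suc (suc zero))) zero (suc zero) = refl
K4m-sym₁₂ (suc (suc (suc zero))) zero (suc (suc zero)) = refl
K4m-sym₁₂ (suc (suc (suc zero))) zero (suc (suc (suc zero))) = refl
K4m-sym₁₂ (suc (suc (suc zero))) (suc zero) zero = refl
K4m-sym₁₂ (suc (suc (suc zero))) (suc zero) (suc zero) = refl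
K4m-sym₁₂ (suc (suc (suc zero))) (suc zero) (suc (suc zero)) = refl
K4m-sym₁₂ (suc (suc (suc zero))) (suc zero) (suc (suc (suc zero))) = refl
K4m-sym₁₂ (suc (suc (suc zero))) (suc (suc zero)) zero = refl
K4m-sym₁₂ (suc (suc (suc zero))) (suc (suc zero)) (suc zero) = refl
K4m-sym₁₂ (suc (suc (suc zero))) (suc (suc zero)) (suc (suc zero)) = refl
K4m-sym₁₂ (suc (suc (suc zero))) (suc (suc zero)) (suc (suc (suc zero))) = refl
K4m-sym₁₂ (suc (suc (suc zero))) (suc (suc (suc zero))) zero = refl
K4m-sym₁₂ (suc (suc (suc zero))) (suc (suc (suc zero))) (suc zero) = refl
K4m-sym₁₂ (suc (suc (suc zero))) (suc (suc (suc zero))) (suc (suc zero)) = refl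
K4m-sym₁₂ (suc (suc (suc zero))) (suc (suc (suc zero))) (suc (suc (suc zero))) = refl

K4m-sym₂₃ : ∀ x y z → K4m-edge x y z ≡ K4m-edge x z y
K4m-sym₂₃ zero zero zero = refl
K4m-sym₂₃ zero zero (suc zero) = refl
K4m-sym₂₃ zero zero (suc (suc zero)) = refl
K4m-sym₂₃ zero zero (suc (suc (suc zero))) = refl
K4m-sym₂₃ zero (suc zero) zero = refl
K4m-sym₂₃ zero (suc zero) (suc zero) = refl
K4m-sym₂₃ zero (suc zero) (suc (suc zero)) = refl
K4m-sym₂₃ zero (suc zero) (suc (suc (suc zero))) = refl
K4m-sym₂₃ zero (suc (suc zero)) zero = refl
K4m-sym₂₃ zero (suc (suc zero)) (suc zero) = refl
K4m-sym₂₃ zero (suc (suc zero)) (suc (suc zero)) = refl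
K4m-sym₂₃ zero (suc (suc zero)) (suc (suc (suc zero))) = refl
K4m-sym₂₃ zero (suc (suc (suc zero))) zero = refl
K4m-sym₂₃ zero (suc (suc (suc zero))) (suc zero) = refl
K4m-sym₂₃ zero (suc (suc (suc zero))) (suc (suc zero)) = refl
K4m-sym₂₃ zero (suc (suc (suc zero))) (suc (suc (suc zero))) = refl
K4m-sym₂₃ (suc zero) zero zero = refl
K4m-sym₂₃ (suc zero) zero (suc zero) = refl
K4m-sym₂₃ (suc zero) zero (suc (suc zero)) = refl
K4m-sym₂₃ (suc zero) zero (suc (suc (suc zero))) = refl
K4m-sym₂₃ (suc zero) (suc zero) zero = refl
K4m-sym₂₃ (suc zero) (suc zero) (suc zero) = refl
K4m-sym₂₃ (suc zero) (suc zero) (suc (suc zero)) = refl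
K4m-sym₂₃ (suc zero) (suc zero) (suc (suc (suc zero))) = refl
K4m-sym₂₃ (suc zero) (suc (suc zero)) zero = refl
K4m-sym₂₃ (suc zero) (suc (suc zero)) (suc zero) = refl
K4m-sym₂₃ (suc zero) (suc (suc zero)) (suc (suc zero)) = refl
K4m-sym₂₃ (suc zero) (suc (suc zero)) (suc (suc (suc zero))) = refl
K4m-sym₂₃ (suc zero) (suc (suc (suc zero))) zero = refl
K4m-sym₂₃ (suc zero) (suc (suc (suc zero))) (suc zero) = refl
K4m-sym₂₃ (suc zero) (suc (suc (suc zero))) (suc (suc zero)) = refl
K4m-sym₂₃ (suc zero) (suc (suc (suc zero))) (suc (suc (suc zero))) = refl
K4m-sym₂₃ (suc (suc zero)) zero zero = refl
K4m-sym₂₃ (suc (suc zero)) zero (suc zero) = refl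
K4m-sym₂₃ (suc (suc zero)) zero (suc (suc zero)) = refl
K4m-sym₂₃ (suc (suc zero)) zero (suc (suc (suc zero))) = refl
K4m-sym₂₃ (suc (suc zero)) (suc zero) zero = refl
K4m-sym₂₃ (suc (suc zero)) (suc zero) (suc zero) = refl
K4m-sym₂₃ (suc (suc zero)) (suc zero) (suc (suc zero)) = refl
K4m-sym₂₃ (suc (suc zero)) (suc zero) (suc (suc (suc zero))) = refl
K4m-sym₂₃ (suc (suc zero)) (suc (suc zero)) zero = refl
K4m-sym₂₃ (suc (suc zero)) (suc (suc zero)) (suc zero) = refl
K4m-sym₂₃ (suc (suc zero)) (suc (suc zero)) (suc (suc zero)) = refl
K4m-sym₂₃ (suc (suc zero)) (suc (suc zero)) (suc (suc (suc zero))) = refl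
K4m-sym₂₃ (suc (suc zero)) (suc (suc (suc zero))) zero = refl
K4m-sym₂₃ (suc (suc zero)) (suc (suc (suc zero))) (suc zero) = refl
K4m-sym₂₃ (suc (suc zero)) (suc (suc (suc zero))) (suc (suc zero)) = refl
K4m-sym₂₃ (suc (suc zero)) (suc (suc (suc zero))) (suc (suc (suc zero))) = refl
K4m-sym₂₃ (suc (suc (suc zero))) zero zero = refl
K4m-sym₂₃ (suc (suc (suc zero))) zero (suc zero) = refl
K4m-sym₂₃ (suc (suc (suc zero))) zero (suc (suc zero)) = refl
K4m-sym₂₃ (suc (suc (suc zero))) zero (suc (suc (suc zero))) = refl
K4m-sym₂₃ (suc (suc (suc zero))) (suc zero) zero = refl
K4m-sym₂₃ (suc (suc (suc zero))) (suc zero) (suc zero) = refl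
K4m-sym₂₃ (suc (suc (suc zero))) (suc zero) (suc (suc zero)) = refl
K4m-sym₂₃ (suc (suc (suc zero))) (suc zero) (suc (suc (suc zero))) = refl
K4m-sym₂₃ (suc (suc (suc zero))) (suc (suc zero)) zero = refl
K4m-sym₂₃ (suc (suc (suc zero))) (suc (suc zero)) (suc zero) = refl
K4m-sym₂₃ (suc (suc (suc zero))) (suc (suc zero)) (suc (suc zero)) = refl
K4m-sym₂₃ (suc (suc (suc zero))) (suc (suc zero)) (suc (suc (suc zero))) = refl
K4m-sym₂₃ (suc (suc (suc zero))) (suc (suc (suc zero))) zero = refl
K4m-sym₂₃ (suc (suc (suc zero))) (suc (suc (suc zero))) (suc zero) = refl
K4m-sym₂₃ (suc (suc (suc zero))) (suc (suc (suc zero))) (suc (suc zero)) = refl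
K4m-sym₂₃ (suc (suc (suc zero))) (suc (suc (suc zero))) (suc (suc (suc zero))) = refl

K4m-irr : ∀ x z → K4m-edge x x z ≡ false
K4m-irr zero zero = refl
K4m-irr zero (suc zero) = refl
K4m-irr zero (suc (suc zero)) = refl
K4m-irr zero (suc (suc (suc zero))) = refl
K4m-irr (suc zero) zero = refl
K4m-irr (suc zero) (suc zero) = refl
K4m-irr (suc zero) (suc (suc zero)) = refl
K4m-irr (suc zero) (suc (suc (suc zero))) = refl
K4m-irr (suc (suc zero)) zero = refl
K4m-irr (suc (suc zero)) (suc zero) = refl
K4m-irr (suc (suc zero)) (suc (suc zero)) = refl
K4m-irr (suc (suc zero)) (suc (suc (suc zero))) = refl
K4m-irr (suc (suc (suc zero))) zero = refl
K4m-irr (suc (suc (suc zero))) (suc zero) = refl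
K4m-irr (suc (suc (suc zero))) (suc (suc zero)) = refl
K4m-irr (suc (suc (suc zero))) (suc (suc (suc zero))) = refl

K4minus : ThreeGraph 4
K4minus = record { edge = K4m-edge ; sym₁₂ = K4m-sym₁₂ ; sym₂₃ = K4m-sym₂₃ ; irr = K4m-irr }

-- Real-number quantities, encoded exactly by integer arithmetic.
-- D(n) = 13n² - 72n + 108 (always > 0), d⋆(n) = (√D - n + 6)/6.

Dn : ℕ → ℤ
Dn n = + (13 Data.Nat.* n Data.Nat.* n) ℤ.- + (72 Data.Nat.* n) ℤ.+ + 108

-- t ≤ s·√D  (s ≥ 0)  ⟺  t ≤ 0 ∨ t² ≤ s²·D
LeSqrt : ℤ → ℤ → ℤ → Set
LeSqrt t s D = (t ℤ.≤ + 0) ⊎ (t ℤ.* t ℤ.≤ s ℤ.* s ℤ.* D)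

-- a ≤ d⋆(n)  ⟺  6a + n - 6 ≤ √D
LeDStar : ℕ → ℤ → Set
LeDStar n a = LeSqrt (+ 6 ℤ.* a ℤ.+ + n ℤ.- + 6) (+ 1) (Dn n)

IsFloorDStar : ℕ → ℤ → Set
IsFloorDStar n a = LeDStar n a × ¬ LeDStar n (a ℤ.+ + 1)

-- k ≤ ((n-1)/2)·d⋆(n)  ⟺  12k + (n-1)(n-6) ≤ (n-1)·√D
LeHalfDStar : ℕ → ℤ → Set
LeHalfDStar n k =
  LeSqrt (+ 12 ℤ.* k ℤ.+ (+ n ℤ.- + 1) ℤ.* (+ n ℤ.- + 6)) (+ n ℤ.- + 1) (Dn n)

IsFloorHalfDStar : ℕ → ℤ → Set
IsFloorHalfDStar n k = LeHalfDStar n k × ¬ LeHalfDStar n (k ℤ.+ + 1)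

-- | c/B - (√13 - 1)/6 | < 1/q   (B > 0, q > 0), i.e.
--   6cq + qB - 6B < qB√13  and  6cq + qB + 6B > qB√13.
CloseToLimit : ℕ → ℕ → ℕ → Set
CloseToLimit c B q =
  ((a ℤ.< + 0) ⊎ (a ℤ.* a ℤ.< + 13 ℤ.* qB ℤ.* qB))
  × ((+ 0 ℤ.< b) × (+ 13 ℤ.* qB ℤ.* qB ℤ.< b ℤ.* b))
  where
    qB : ℤ
    qB = + (q Data.Nat.* B)
    a : ℤ
    a = + (6 Data.Nat.* c Data.Nat.* q) ℤ.+ qB ℤ.- + (6 Data.Nat.* B)
    b : ℤ
    b = + (6 Data.Nat.* c Data.Nat.* q) ℤ.+ qB ℤ.+ + (6 Data.Nat.* B)

{-# OPTIONS --safe #-}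

-- Let x be an uncovered vertex and L its link, a graph on the other N = n − 1 vertices.  Then L is
-- triangle-free and every edge of the 3-graph avoiding x spans at most one edge of L (is "sparse").
-- Counting sparse triples at a vertex a of L gives deg(a) ≤ C(N−1,2) + (5 d(a) − d(a)²)/2 − Σ_{b ~ a} d(b);
-- summing over a and applying Cauchy–Schwarz to Σ d(a)² bounds the minimum degree δ through
-- 3t² + (n − 6)t ≤ (n − 2)(n − 3) with t = 2δ/N, i.e. t ≤ d⋆.  Conversely, taking all sparse triples over a
-- d-regular bipartite L (with an isolated vertex if N is odd) attains δ ≥ ⌊N/2⌋ d as long as d ≤ d⋆,
-- which is enough for the limit as well.
module Submission where

open import Defs
open import Relation.Binary.PropositionalEquality

-- A d-regular L turns Cauchy-Schwarz into an equality, and the degree Nd/2 of x then balances that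
-- of every other vertex in the densest 3-graph over L exactly when 3d² + (n - 6)d = (n - 2)(n - 3).
-- The positive root is d⋆, so the gap between the two bounds is only the rounding of d⋆.
-- Asymptotically d = τn with 3τ² + τ = 1, that is τ = (√13 - 1)/6 ≈ 0.43; as τ < 1/2, a bipartite
-- graph on two equal classes has room for this degree. The minimum degree acts in two opposite
-- ways: at x it forces L to have many edges, at the other vertices it forbids too many. Square
-- roots never occur: comparisons with d⋆ and √13 are squared, and differences are displayed as
-- visibly nonnegative polynomials. Counts over ℕ stay additive to avoid subtraction, and degrees
-- are doubled because sums run over ordered pairs. Since c₁ is a maximum, its existence needs
-- proof: coverings are decidable, and all 3-graphs on n vertices are searched.

module IntegerArithmetic where
  open import Data.Integer as ℤ using (ℤ; +_; -[1+_]; 0ℤ; +≤+; +<+; _+_; _*_; _-_; _≤_; _<_)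
  open import Data.Integer.Properties
  open import Data.Integer.Tactic.RingSolver using (solve-∀)
  open import Data.Nat as ℕ using (ℕ; zero; suc; z≤n; s≤s)
  import Data.Nat.Properties as ℕ
  open import Data.Fin using (Fin)
  open import Data.Fin.Patterns using (0F; 1F)
  open import Data.Product using (_×_; _,_)
  open import Data.Sum using (_⊎_; inj₁; inj₂)
  open import Data.Vec using (Vec; []; _∷_; lookup)
  open import Relation.Nullary using (¬_; yes; no; contradiction)

  -- Transfer of polynomial inequalities between ℕ and ℤ.

  infixl 6 _⊞_
  infixl 7 _⊠_

  -- `+_` commutes with sums by computation but with products only through `pos-*`. One syntax with
  -- two evaluations lets `cast` push `pos-*` through a whole polynomial at once.
  data Poly (n : ℕ) : Set where
    con     : ℕ → Poly n
    var     : Fin n → Poly n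
    _⊞_ _⊠_ : Poly n → Poly n → Poly n

  ⟦_⟧ : ∀ {n} → Poly n → Vec ℕ n → ℕ
  ⟦ con k ⟧ ρ = k
  ⟦ var i ⟧ ρ = lookup ρ i
  ⟦ p ⊞ q ⟧ ρ = ⟦ p ⟧ ρ ℕ.+ ⟦ q ⟧ ρ
  ⟦ p ⊠ q ⟧ ρ = ⟦ p ⟧ ρ ℕ.* ⟦ q ⟧ ρ

  ⟦_⟧ᶻ : ∀ {n} → Poly n → Vec ℕ n → ℤ
  ⟦ con k ⟧ᶻ ρ = + k
  ⟦ var i ⟧ᶻ ρ = + lookup ρ i
  ⟦ p ⊞ q ⟧ᶻ ρ = ⟦ p ⟧ᶻ ρ + ⟦ q ⟧ᶻ ρ
  ⟦ p ⊠ q ⟧ᶻ ρ = ⟦ p ⟧ᶻ ρ * ⟦ q ⟧ᶻ ρ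

  cast : ∀ {n} (p : Poly n) ρ → + ⟦ p ⟧ ρ ≡ ⟦ p ⟧ᶻ ρ
  cast (con k) ρ = refl
  cast (var i) ρ = refl
  cast (p ⊞ q) ρ = cong₂ _+_ (cast p ρ) (cast q ρ)
  cast (p ⊠ q) ρ = trans (pos-* (⟦ p ⟧ ρ) (⟦ q ⟧ ρ)) (cong₂ _*_ (cast p ρ) (cast q ρ))

  cast-≤ : ∀ {n} (p q : Poly n) ρ → ⟦ p ⟧ ρ ℕ.≤ ⟦ q ⟧ ρ → ⟦ p ⟧ᶻ ρ ≤ ⟦ q ⟧ᶻ ρ
  cast-≤ p q ρ h = subst₂ _≤_ (cast p ρ) (cast q ρ) (+≤+ h)

  uncast-≤ : ∀ {n} (p q : Poly n) ρ → ⟦ p ⟧ᶻ ρ ≤ ⟦ q ⟧ᶻ ρ → ⟦ p ⟧ ρ ℕ.≤ ⟦ q ⟧ ρ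
  uncast-≤ p q ρ h = drop‿+≤+ (subst₂ _≤_ (sym (cast p ρ)) (sym (cast q ρ)) h)

  0≤+ : ∀ n → 0ℤ ≤ + n
  0≤+ n = +≤+ z≤n

  0≤-* : ∀ {i j} → 0ℤ ≤ i → 0ℤ ≤ j → 0ℤ ≤ i * j
  0≤-* {+ m} {+ n} _ _ = subst (0ℤ ≤_) (pos-* m n) (0≤+ (m ℕ.* n))

  0<-* : ∀ {i j} → 0ℤ < i → 0ℤ < j → 0ℤ < i * j
  0<-* {+ suc m} {+ suc n} _ _ = +<+ (s≤s z≤n)
  0<-* {+ zero}  (+<+ ()) _
  0<-* {+ suc m} {+ zero} _ (+<+ ())

  0<+suc : ∀ n → 0ℤ < + suc n
  0<+suc n = +<+ (s≤s z≤n)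

  0≤-+ : ∀ {i j} → 0ℤ ≤ i → 0ℤ ≤ j → 0ℤ ≤ i + j
  0≤-+ = +-mono-≤

  -- The working form of the later estimates: the ring solver checks that a difference equals `e`,
  -- and `e` is built from sums and products with evident signs.
  ≤-by : ∀ {i j e} → j - i ≡ e → 0ℤ ≤ e → i ≤ j
  ≤-by eq 0≤e = 0≤i-j⇒j≤i (subst (0ℤ ≤_) (sym eq) 0≤e)

  <-by : ∀ {i j e} → j - i ≡ e → 0ℤ < e → i < j
  <-by {i} {j} {e} eq 0<e = subst₂ _<_ (+-identityʳ i) (trans (cong (λ e → i + e) (sym eq)) (i+[j-i] i j)) (+-monoʳ-< i 0<e)
    where
    i+[j-i] : ∀ i j → i + (j - i) ≡ j
    i+[j-i] = solve-∀

  square-mono : ∀ {i j} → 0ℤ ≤ i → i ≤ j → i * i ≤ j * j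
  square-mono {i} {j} 0≤i i≤j = ≤-by (factor i j) (0≤-* (i≤j⇒0≤j-i i≤j) (0≤-+ (≤-trans 0≤i i≤j) 0≤i))
    where
    factor : ∀ i j → j * j - i * i ≡ (j - i) * (j + i)
    factor = solve-∀

  -- With N = n ∸ 1, the relation Quad N d says d ≤ d⋆(n), and Quad² k c says c ≤ N d⋆(n) / 2 for N = 2 + k.
  Quad : ℕ → ℕ → Set
  Quad N d = 3 ℕ.* (d ℕ.* d) ℕ.+ N ℕ.* d ℕ.+ 3 ℕ.* N ℕ.≤ 2 ℕ.+ N ℕ.* N ℕ.+ 5 ℕ.* d

  Quad² : ℕ → ℕ → Set
  Quad² k c = let N = 2 ℕ.+ k in
    N ℕ.* N ℕ.* (2 ℕ.* c) ℕ.+ 3 ℕ.* (2 ℕ.* c ℕ.* (2 ℕ.* c)) ℕ.≤ N ℕ.* N ℕ.* ((1 ℕ.+ k) ℕ.* k) ℕ.+ 5 ℕ.* N ℕ.* (2 ℕ.* c)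

  module _ where
    private
      d N k c : Poly 2
      N = var 0F
      d = var 1F
      k = var 0F
      c = var 1F
      quadˡ quadʳ quad²ˡ quad²ʳ : Poly 2
      quadˡ = con 3 ⊠ (d ⊠ d) ⊞ N ⊠ d ⊞ con 3 ⊠ N
      quadʳ = con 2 ⊞ N ⊠ N ⊞ con 5 ⊠ d
      quad²ˡ = (con 2 ⊞ k) ⊠ (con 2 ⊞ k) ⊠ (con 2 ⊠ c) ⊞ con 3 ⊠ (con 2 ⊠ c ⊠ (con 2 ⊠ c))
      quad²ʳ = (con 2 ⊞ k) ⊠ (con 2 ⊞ k) ⊠ ((con 1 ⊞ k) ⊠ k) ⊞ con 5 ⊠ (con 2 ⊞ k) ⊠ (con 2 ⊠ c)

    quad-from-ℤ : ∀ N d → + 3 * (+ d * + d) + + N * + d + + 3 * + N ≤ + 2 + + N * + N + + 5 * + d → Quad N d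
    quad-from-ℤ N d = uncast-≤ quadˡ quadʳ (N ∷ d ∷ [])

    ¬quad-to-ℤ : ∀ N d → ¬ Quad N d → + 2 + + N * + N + + 5 * + d ≤ + 3 * (+ d * + d) + + N * + d + + 3 * + N
    ¬quad-to-ℤ N d ¬q = cast-≤ quadʳ quadˡ (N ∷ d ∷ []) (ℕ.<⇒≤ (ℕ.≰⇒> ¬q))

    quad²-to-ℤ : ∀ k c → Quad² k c → let z = + 2 + + k in
      z * z * (+ 2 * + c) + + 3 * (+ 2 * + c * (+ 2 * + c)) ≤ z * z * ((+ 1 + + k) * + k) + + 5 * z * (+ 2 * + c)
    quad²-to-ℤ k c = cast-≤ quad²ˡ quad²ʳ (k ∷ c ∷ [])

  Dn-suc : ∀ N → Dn (suc N) ≡ + 13 * (+ N * + N) - + 46 * + N + + 49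
  Dn-suc N = trans (cong₂ (λ x y → x - y + + 108) (cast (con 13 ⊠ (con 1 ⊞ var 0F) ⊠ (con 1 ⊞ var 0F)) (N ∷ []))
                                                  (cast (con 72 ⊠ (con 1 ⊞ var 0F)) (N ∷ []))) (expand (+ N))
    where
    expand : ∀ z → + 13 * (+ 1 + z) * (+ 1 + z) - + 72 * (+ 1 + z) + + 108 ≡ + 13 * (z * z) - + 46 * z + + 49
    expand = solve-∀

  -- Completing the square in `Quad` gives D - t² = 12 · (right side - left side) with t = 6d + N -
  -- 5, because (N - 5)² + 12(N - 1)(N - 2) = 13N² - 46N + 49 is D. The argument `suc d` makes t
  -- positive, which rules out the trivial branch of `LeSqrt`.
  ≤d⋆⇒Quad : ∀ k d → LeDStar (3 ℕ.+ k) (+ suc d) → Quad (2 ℕ.+ k) (suc d)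
  ≤d⋆⇒Quad k d (inj₁ t≤0) = contradiction (≤-trans positive t≤0) λ { (+≤+ ()) }
    where
    expand : ∀ k d → + 6 * (+ 1 + d) + (+ 3 + k) - + 6 - + 3 ≡ + 6 * d + k
    expand = solve-∀
    positive : + 3 ≤ + 6 * + suc d + + (3 ℕ.+ k) - + 6
    positive = ≤-by (expand (+ k) (+ d)) (0≤-+ (0≤-* (0≤+ 6) (0≤+ d)) (0≤+ k))
  ≤d⋆⇒Quad k d (inj₂ t²≤D) = quad-from-ℤ N (suc d) (*-cancelˡ-≤-pos _ _ (+ 12)
    (≤-by (expand (+ N) (+ suc d)) (i≤j⇒0≤j-i (subst (λ D → t * t ≤ + 1 * + 1 * D) (Dn-suc N) t²≤D))))
    where
    N = 2 ℕ.+ k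
    t = + 6 * + suc d + + suc N - + 6
    expand : ∀ z d → + 12 * (+ 2 + z * z + + 5 * d) - + 12 * (+ 3 * (d * d) + z * d + + 3 * z)
      ≡ + 1 * + 1 * (+ 13 * (z * z) - + 46 * z + + 49) - (+ 6 * d + (+ 1 + z) - + 6) * (+ 6 * d + (+ 1 + z) - + 6)
    expand = solve-∀

  -- The same completed square with 2c/N in place of d, multiplied by N².
  Quad²⇒≤half-d⋆ : ∀ k c → Quad² k c → LeHalfDStar (3 ℕ.+ k) (+ c)
  Quad²⇒≤half-d⋆ k c h = inj₂ (subst (λ D → t * t ≤ (+ suc N - + 1) * (+ suc N - + 1) * D) (sym (Dn-suc N))
    (≤-by (expand (+ k) (+ c)) (0≤-* (0≤+ 12) (i≤j⇒0≤j-i (quad²-to-ℤ k c h)))))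
    where
    N = 2 ℕ.+ k
    t = + 12 * + c + (+ suc N - + 1) * (+ suc N - + 6)
    expand : ∀ k c → let z = + 2 + k ; n = + 1 + z ; t = + 12 * c + (n - + 1) * (n - + 6) in
      (n - + 1) * (n - + 1) * (+ 13 * (z * z) - + 46 * z + + 49) - t * t
      ≡ + 12 * (z * z * ((+ 1 + k) * k) + + 5 * z * (+ 2 * c) - (z * z * (+ 2 * c) + + 3 * (+ 2 * c * (+ 2 * c))))
    expand = solve-∀

  LeSqrt-mono : ∀ {t u} s D → t ≤ u → LeSqrt u s D → LeSqrt t s D
  LeSqrt-mono s D t≤u (inj₁ u≤0) = inj₁ (≤-trans t≤u u≤0)
  LeSqrt-mono {t} s D t≤u (inj₂ u²≤) with ≤-total t 0ℤ
  ... | inj₁ t≤0 = inj₁ t≤0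
  ... | inj₂ 0≤t = inj₂ (≤-trans (square-mono 0≤t t≤u) u²≤)

  floor-half-d⋆-≥ : ∀ n {c k} → LeHalfDStar n c → IsFloorHalfDStar n k → c ≤ k
  floor-half-d⋆-≥ n {c} {k} c≤ (_ , ¬k+1≤) with c ≤? k
  ... | yes c≤k = c≤k
  ... | no  c≰k = contradiction (LeSqrt-mono (+ n - + 1) (Dn n) (+-monoˡ-≤ r (*-monoˡ-≤-nonNeg (+ 12) k+1≤c)) c≤) ¬k+1≤
    where
    r = (+ n - + 1) * (+ n - + 6)
    k+1≤c : k + + 1 ≤ c
    k+1≤c = subst (_≤ c) (+-comm (+ 1) k) (i<j⇒suc[i]≤j (≰⇒> c≰k))

  -- Approximation of the density (√13 - 1)/6 within 1/q.

  module Limit (k c b q : ℤ) (0≤k : 0ℤ ≤ k) (0≤c : 0ℤ ≤ c) (0<b : 0ℤ < b) (0<q : 0ℤ < q)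
               (2b≡ : + 2 * b ≡ (+ 2 + k) * (+ 1 + k)) where
    -- `z` is N = n - 1, `y` is N - 1, and `b` is the binomial coefficient of N over 2. The choice
    -- of `w` comes from c/b ≤ (√13 - 1)/6 being equivalent to 6c + b ≤ √13 b.
    z y w : ℤ
    z = + 2 + k
    y = + 1 + k
    w = + 6 * c + b

    0≤b : 0ℤ ≤ b
    0≤b = <⇒≤ 0<b
    0≤q : 0ℤ ≤ q
    0≤q = <⇒≤ 0<q
    0<y : 0ℤ < y
    0<y = +-mono-<-≤ (0<+suc 0) 0≤k
    0<z : 0ℤ < z
    0<z = +-mono-<-≤ (0<+suc 1) 0≤k
    0≤w : 0ℤ ≤ w
    0≤w = 0≤-+ (0≤-* (0≤+ 6) 0≤c) 0≤b

    -- After substituting zy for 2b, `Quad²` says w² ≤ 13b² up to the error 24zc, which is of order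
    -- N³ against b² of order N⁴.
    w²-bound : z * z * (+ 2 * c) + + 3 * (+ 2 * c * (+ 2 * c)) ≤ z * z * (y * k) + + 5 * z * (+ 2 * c) →
               0ℤ ≤ + 13 * (b * b) + + 24 * z * c - w * w
    w²-bound h = subst (0ℤ ≤_) (sym (begin
      + 13 * (b * b) + + 24 * z * c - w * w          ≡⟨ in-2b b c (+ 24 * z * c) ⟩
      F (+ 2 * b)                                    ≡⟨ cong F 2b≡ ⟩
      F (z * y)                                      ≡⟨ final k c ⟩
      + 3 * (U - L) + + 3 * (z * z * y)              ∎))
      (0≤-+ (0≤-* (0≤+ 3) (i≤j⇒0≤j-i h)) (0≤-* (0≤+ 3) (0≤-* (0≤-* (<⇒≤ 0<z) (<⇒≤ 0<z)) (<⇒≤ 0<y))))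
      where
      open ≡-Reasoning
      L U : ℤ
      L = z * z * (+ 2 * c) + + 3 * (+ 2 * c * (+ 2 * c))
      U = z * z * (y * k) + + 5 * z * (+ 2 * c)
      F : ℤ → ℤ
      F t = + 3 * (t * t) + + 24 * z * c - + 36 * (c * c) - + 6 * c * t
      in-2b : ∀ b c r → + 13 * (b * b) + r - (+ 6 * c + b) * (+ 6 * c + b)
        ≡ + 3 * (+ 2 * b * (+ 2 * b)) + r - + 36 * (c * c) - + 6 * c * (+ 2 * b)
      in-2b = solve-∀
      final : ∀ k c → let z = + 2 + k ; y = + 1 + k in
        + 3 * (z * y * (z * y)) + + 24 * z * c - + 36 * (c * c) - + 6 * c * (z * y)
        ≡ + 3 * (z * z * (y * k) + + 5 * z * (+ 2 * c) - (z * z * (+ 2 * c) + + 3 * (+ 2 * c * (+ 2 * c)))) + + 3 * (z * z * y)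
      final = solve-∀

    -- As a = qw - 6b, one has q²w² - a² = 6b(a + qw). For a ≥ 0 this gain, of order qN⁴, exceeds q²
    -- times the error of `w²-bound` once 2q ≤ N - 1.
    upper : z * z * (+ 2 * c) + + 3 * (+ 2 * c * (+ 2 * c)) ≤ z * z * (y * k) + + 5 * z * (+ 2 * c) →
            + 2 * q ≤ y → let a = + 6 * c * q + q * b - + 6 * b in
            (a < 0ℤ) ⊎ (a * a < + 13 * (q * b) * (q * b))
    upper h 2q≤y with + 6 * c * q + q * b - + 6 * b <? 0ℤ
    ... | yes a<0 = inj₁ a<0
    ... | no  a≮0 = inj₂ (<-by (begin
      + 13 * (q * b) * (q * b) - a * a                                     ≡⟨ in-2b b c q z ⟩
      q * q * (+ 13 * (b * b) + + 24 * z * c - w * w) + + 6 * b * a + + 3 * q * ((+ 2 * b) * w - + 8 * z * c * q)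
        ≡⟨ cong (λ t → q * q * (+ 13 * (b * b) + + 24 * z * c - w * w) + + 6 * b * a + + 3 * q * (t * w - + 8 * z * c * q)) 2b≡ ⟩
      q * q * (+ 13 * (b * b) + + 24 * z * c - w * w) + + 6 * b * a + + 3 * q * (z * y * w - + 8 * z * c * q)
        ≡⟨ final (q * q * (+ 13 * (b * b) + + 24 * z * c - w * w) + + 6 * b * a) b c q z y ⟩
      q * q * (+ 13 * (b * b) + + 24 * z * c - w * w) + + 6 * b * a
        + (+ 3 * q * z * ((y - + 2 * q) * w + + 4 * q * c) + + 6 * q * z * (q * b))  ∎)
      (+-mono-≤-< (0≤-+ (0≤-* (0≤-* 0≤q 0≤q) (w²-bound h)) (0≤-* (0≤-* (0≤+ 6) 0≤b) (≮⇒≥ a≮0)))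
        (+-mono-≤-< (0≤-* (0≤-* (0≤-* (0≤+ 3) 0≤q) (<⇒≤ 0<z)) (0≤-+ (0≤-* (i≤j⇒0≤j-i 2q≤y) 0≤w) (0≤-* (0≤-* (0≤+ 4) 0≤q) 0≤c)))
          (0<-* (0<-* (0<-* (0<+suc 5) 0<q) 0<z) (0<-* 0<q 0<b)))))
      where
      open ≡-Reasoning
      a = + 6 * c * q + q * b - + 6 * b
      in-2b : ∀ b c q z → let a = + 6 * c * q + q * b - + 6 * b ; w = + 6 * c + b in
        + 13 * (q * b) * (q * b) - a * a
        ≡ q * q * (+ 13 * (b * b) + + 24 * z * c - w * w) + + 6 * b * a + + 3 * q * ((+ 2 * b) * w - + 8 * z * c * q)
      in-2b = solve-∀
      final : ∀ r b c q z y → let w = + 6 * c + b in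
        r + + 3 * q * (z * y * w - + 8 * z * c * q)
        ≡ r + (+ 3 * q * z * ((y - + 2 * q) * w + + 4 * q * c) + + 6 * q * z * (q * b))
      final = solve-∀

    -- The hypothesis `next` is the failure of `Quad` at d + 1, which puts 6d + N above √13 N up to
    -- lower-order terms. The construction gives c ≥ (N - 1)d/2, hence 2b′ ≥ yX; the summand 6z of
    -- `X`, which stems from 6b, is the tolerance 1/q and absorbs the loss once 4q ≤ N. Both sides
    -- are multiplied by 4 because only 2b is available as a polynomial.
    lower : ∀ d → 0ℤ ≤ d → y * d ≤ + 2 * c →
            + 2 + z * z + + 5 * (+ 1 + d) ≤ + 3 * ((+ 1 + d) * (+ 1 + d)) + z * (+ 1 + d) + + 3 * z →
            + 4 * q ≤ z → let b′ = + 6 * c * q + q * b + + 6 * b in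
            (0ℤ < b′) × (+ 13 * (q * b) * (q * b) < b′ * b′)
    lower d 0≤d yd≤2c next 4q≤z = positive , *-cancelˡ-<-nonNeg (+ 4) (<-by (begin
      + 4 * (b′ * b′) - + 4 * (+ 13 * (q * b) * (q * b))                 ≡⟨ in-2b b′ b q (y * X) ⟩
      (+ 2 * b′) * (+ 2 * b′) - y * X * (y * X) + (y * X * (y * X) - + 13 * (q * q) * (+ 2 * b * (+ 2 * b)))
        ≡⟨ cong (λ t → (+ 2 * b′) * (+ 2 * b′) - y * X * (y * X) + (y * X * (y * X) - + 13 * (q * q) * (t * t))) 2b≡ ⟩
      (+ 2 * b′) * (+ 2 * b′) - y * X * (y * X) + (y * X * (y * X) - + 13 * (q * q) * (z * y * (z * y)))
        ≡⟨ cong (λ t → (+ 2 * b′) * (+ 2 * b′) - y * X * (y * X) + t) (final d q y z) ⟩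
      (+ 2 * b′) * (+ 2 * b′) - y * X * (y * X)
        + y * y * (+ 12 * (q * q) * (R - L) + + 12 * q * (d * (+ 5 * z + (z - + 4 * q) + + 3 * q) + z * (z - + 4 * q)) + + 36 * (z * z) + + 48 * (q * q)) ∎)
      (+-mono-≤-< (i≤j⇒0≤j-i (square-mono 0≤yX yX≤2b′))
        (0<-* (0<-* 0<y 0<y) (+-mono-≤-< (0≤-+ (0≤-+
            (0≤-* (0≤-* (0≤+ 12) (0≤-* 0≤q 0≤q)) (i≤j⇒0≤j-i next))
            (0≤-* (0≤-* (0≤+ 12) 0≤q) (0≤-+ (0≤-* 0≤d (0≤-+ (0≤-+ (0≤-* (0≤+ 5) 0≤z) 0≤z-4q) (0≤-* (0≤+ 3) 0≤q))) (0≤-* 0≤z 0≤z-4q))))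
            (0≤-* (0≤+ 36) (0≤-* 0≤z 0≤z)))
          (0<-* (0<+suc 47) (0<-* 0<q 0<q))))))
      where
      open ≡-Reasoning
      b′ X L R : ℤ
      b′ = + 6 * c * q + q * b + + 6 * b
      X = q * (+ 6 * d + z) + + 6 * z
      L = + 2 + z * z + + 5 * (+ 1 + d)
      R = + 3 * ((+ 1 + d) * (+ 1 + d)) + z * (+ 1 + d) + + 3 * z
      0≤z : 0ℤ ≤ z
      0≤z = <⇒≤ 0<z
      0≤z-4q : 0ℤ ≤ z - + 4 * q
      0≤z-4q = i≤j⇒0≤j-i 4q≤z
      positive : 0ℤ < b′
      positive = +-mono-≤-< (0≤-+ (0≤-* (0≤-* (0≤+ 6) 0≤c) 0≤q) (0≤-* 0≤q 0≤b)) (0<-* (0<+suc 5) 0<b)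
      0≤yX : 0ℤ ≤ y * X
      0≤yX = 0≤-* (<⇒≤ 0<y) (0≤-+ (0≤-* 0≤q (0≤-+ (0≤-* (0≤+ 6) 0≤d) 0≤z)) (0≤-* (0≤+ 6) 0≤z))
      2b′-in-2b : ∀ b c q → + 2 * (+ 6 * c * q + q * b + + 6 * b) ≡ + 12 * c * q + (q + + 6) * (+ 2 * b)
      2b′-in-2b = solve-∀
      slack : ∀ c q d y z → + 12 * c * q + (q + + 6) * (z * y) - y * (q * (+ 6 * d + z) + + 6 * z) ≡ + 6 * q * (+ 2 * c - y * d)
      slack = solve-∀
      yX≤2b′ : y * X ≤ + 2 * b′
      yX≤2b′ = ≤-by (trans (cong (λ t → t - y * X) (trans (2b′-in-2b b c q) (cong (λ t → + 12 * c * q + (q + + 6) * t) 2b≡))) (slack c q d y z))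
        (0≤-* (0≤-* (0≤+ 6) 0≤q) (i≤j⇒0≤j-i yd≤2c))
      in-2b : ∀ b′ b q s → + 4 * (b′ * b′) - + 4 * (+ 13 * (q * b) * (q * b))
        ≡ (+ 2 * b′) * (+ 2 * b′) - s * s + (s * s - + 13 * (q * q) * (+ 2 * b * (+ 2 * b)))
      in-2b = solve-∀
      final : ∀ d q y z → let X = q * (+ 6 * d + z) + + 6 * z in
        y * X * (y * X) - + 13 * (q * q) * (z * y * (z * y))
        ≡ y * y * (+ 12 * (q * q) * (+ 3 * ((+ 1 + d) * (+ 1 + d)) + z * (+ 1 + d) + + 3 * z - (+ 2 + z * z + + 5 * (+ 1 + d)))
          + + 12 * q * (d * (+ 5 * z + (z - + 4 * q) + + 3 * q) + z * (z - + 4 * q)) + + 36 * (z * z) + + 48 * (q * q))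
      final = solve-∀

open IntegerArithmetic
open import Data.Bool using (Bool; true; false; _∧_; not; T?)
open import Data.Bool.Properties using () renaming (_≟_ to _≟ᵇ_)
open import Data.Empty using (⊥; ⊥-elim)
open import Data.Fin using (Fin; zero; suc; toℕ; _≟_; punchIn; _↑ˡ_; _↑ʳ_; splitAt; combine; remQuot)
open import Data.Fin.Patterns using (0F; 1F)
open import Data.Fin.Properties using (toℕ-injective; toℕ<n; punchInᵢ≢i; any?; all?; ¬∀⟶∃¬; remQuot-combine; splitAt-↑ˡ; splitAt-↑ʳ)
open import Data.Fin.Subset using (Subset)
open import Data.Fin.Subset.Properties using (anySubset?)
open import Data.List using ([]; _∷_; _++_; map; length; cartesianProduct; allFin; tabulate)
open import Data.List.Properties using (length-filter)
open import Data.Nat using (ℕ; zero; suc; _+_; _*_; _≤_; _<_; z≤n; s≤s; _<ᵇ_; _≡ᵇ_; _≤?_; _%_; NonZero) renaming (_≟_ to _≟ⁿ_)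
open import Data.Nat.Combinatorics using (_C_; nC1≡n; nCk+nC[k+1]≡[n+1]C[k+1])
open import Data.Nat.DivMod using ([m+n]%n≡m%n; [m+kn]%n≡m%n; m<n⇒m%n≡m)
open import Data.Nat.Properties hiding (_≟_)
import Algebra.Properties.Semiring.Sum +-*-semiring as Sum
open import Data.Nat.Tactic.RingSolver using (solve-∀)
open import Data.Product using (Σ; ∃; ∃-syntax; _×_; _,_; proj₁; proj₂; uncurry)
open import Data.Sum using (_⊎_; inj₁; inj₂; map₂)
open import Data.Vec as Vec using ([]; _∷_)
open import Data.Vec.Properties using (lookup∘tabulate)
open import Function using (_∘_; id)
open import Relation.Binary.Definitions using (tri<; tri≈; tri>)
open import Relation.Nullary using (¬_; Dec; yes; no; does; contradiction; ¬?)
open import Relation.Nullary.Decidable using (map′; _×-dec_; _⊎-dec_)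

-- Sums and degrees

ι : Bool → ℕ
ι false = 0
ι true  = 1

-- Opaque, so that the size and the summand can be inferred from a sum.
opaque
  sum : ∀ {n} → (Fin n → ℕ) → ℕ
  sum = Sum.sum

  sum-zero : (f : Fin 0 → ℕ) → sum f ≡ 0
  sum-zero f = refl

  sum-suc : ∀ {n} (f : Fin (suc n) → ℕ) → sum f ≡ f zero + sum (f ∘ suc)
  sum-suc f = refl

  sum-cong : ∀ {n} {f g : Fin n → ℕ} → (∀ i → f i ≡ g i) → sum f ≡ sum g
  sum-cong {n} = Sum.sum-cong-≗ {n}

  sum-+ : ∀ {n} (f g : Fin n → ℕ) → sum (λ i → f i + g i) ≡ sum f + sum g
  sum-+ {n} = Sum.∑-distrib-+ {n}

  sum-*ˡ : ∀ {n} x (f : Fin n → ℕ) → sum (λ i → x * f i) ≡ x * sum f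
  sum-*ˡ {n} x f = sym (Sum.*-distribˡ-sum {n} x f)

  sum-*ʳ : ∀ {n} x (f : Fin n → ℕ) → sum (λ i → f i * x) ≡ sum f * x
  sum-*ʳ {n} x f = sym (Sum.*-distribʳ-sum {n} x f)

  sum-comm : ∀ {m n} (f : Fin m → Fin n → ℕ) → sum (λ i → sum (f i)) ≡ sum (λ j → sum (λ i → f i j))
  sum-comm {m} {n} = Sum.∑-comm {m} {n}

  sum-remove : ∀ {n} (i : Fin (suc n)) (f : Fin (suc n) → ℕ) → sum f ≡ f i + sum (f ∘ punchIn i)
  sum-remove {n} i = Sum.sum-remove {n} {i}

  sum-last : ∀ {n} (f : ℕ → ℕ) → sum {suc n} (f ∘ toℕ) ≡ sum {n} (f ∘ toℕ) + f n
  sum-last {zero}  f = +-identityʳ (f 0)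
  sum-last {suc n} f = trans (cong (f 0 +_) (sum-last (f ∘ suc))) (sym (+-assoc (f 0) _ _))

  sum-mono-≤ : ∀ {n} {f g : Fin n → ℕ} → (∀ i → f i ≤ g i) → sum f ≤ sum g
  sum-mono-≤ {zero}  f≤g = z≤n
  sum-mono-≤ {suc n} f≤g = +-mono-≤ (f≤g zero) (sum-mono-≤ (f≤g ∘ suc))

  sum-const : ∀ n x → sum {n} (λ _ → x) ≡ n * x
  sum-const zero    x = refl
  sum-const (suc n) x = cong (x +_) (sum-const n x)

  sum-↑ : ∀ m {n} (f : Fin (m + n) → ℕ) → sum f ≡ sum (λ i → f (i ↑ˡ n)) + sum (λ i → f (m ↑ʳ i))
  sum-↑ zero    f = refl
  sum-↑ (suc m) f = trans (cong (f zero +_) (sum-↑ m (f ∘ suc))) (sym (+-assoc (f zero) _ _))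

sum₂ : ∀ {m n} → (Fin m → Fin n → ℕ) → ℕ
sum₂ f = sum (λ i → sum (f i))

sum₂-cong : ∀ {m n} {f g : Fin m → Fin n → ℕ} → (∀ i j → f i j ≡ g i j) → sum₂ f ≡ sum₂ g
sum₂-cong f≗g = sum-cong λ i → sum-cong (f≗g i)

sum₂-+ : ∀ {m n} (f g : Fin m → Fin n → ℕ) → sum₂ (λ i j → f i j + g i j) ≡ sum₂ f + sum₂ g
sum₂-+ f g = trans (sum-cong λ i → sum-+ (f i) (g i)) (sum-+ (λ i → sum (f i)) (λ i → sum (g i)))

sum₂-mono-≤ : ∀ {m n} {f g : Fin m → Fin n → ℕ} → (∀ i j → f i j ≤ g i j) → sum₂ f ≤ sum₂ g
sum₂-mono-≤ f≤g = sum-mono-≤ λ i → sum-mono-≤ (f≤g i)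

sum₂-const : ∀ m n x → sum₂ {m} {n} (λ _ _ → x) ≡ m * (n * x)
sum₂-const m n x = trans (sum-cong λ (_ : Fin m) → sum-const n x) (sum-const m (n * x))

-- The inequality 2 f(i) f(j) ≤ f(i)² + f(j)² summed over all ordered pairs; `ordered` proves it by
-- writing the larger number as a + e.
cauchy-schwarz : ∀ {n} (f : Fin n → ℕ) → sum f * sum f ≤ n * sum (λ i → f i * f i)
cauchy-schwarz {n} f = *-cancelˡ-≤ 2 (begin
  2 * (sum f * sum f)                                                ≡⟨ cong (2 *_) square ⟩
  2 * sum₂ (λ i j → f i * f j)                                       ≡⟨ sum-*ˡ 2 _ ⟨
  sum (λ i → 2 * sum (λ j → f i * f j))                              ≡⟨ sum-cong (λ i → sum-*ˡ 2 (λ j → f i * f j)) ⟨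
  sum₂ (λ i j → 2 * (f i * f j))                                     ≤⟨ sum₂-mono-≤ (λ i j → am-gm (f i) (f j)) ⟩
  sum₂ (λ i j → f i * f i + f j * f j)                               ≡⟨ sum₂-+ _ _ ⟩
  sum₂ (λ i _ → f i * f i) + sum₂ {n} {n} (λ _ j → f j * f j)        ≡⟨ cong₂ _+_ (sum-cong (λ i → sum-const n (f i * f i))) (sum-const n _) ⟩
  sum (λ i → n * (f i * f i)) + n * sum (λ j → f j * f j)            ≡⟨ cong (_+ n * Q) (sum-*ˡ n _) ⟩
  n * Q + n * Q                                                      ≡⟨ double (n * Q) ⟨
  2 * (n * Q)                                                        ∎)
  where
  open ≤-Reasoning
  Q = sum (λ i → f i * f i)

  double : ∀ x → 2 * x ≡ x + x
  double = solve-∀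

  square : sum f * sum f ≡ sum₂ (λ i j → f i * f j)
  square = trans (sym (sum-*ʳ (sum f) f)) (sum-cong λ i → sym (sum-*ˡ (f i) f))

  identity : ∀ a e → 2 * (a * (a + e)) + e * e ≡ a * a + (a + e) * (a + e)
  identity = solve-∀

  ordered : ∀ {a b} → a ≤ b → 2 * (a * b) ≤ a * a + b * b
  ordered {a} a≤b with m≤n⇒∃[o]m+o≡n a≤b
  ... | e , refl = ≤-trans (m≤m+n _ (e * e)) (≤-reflexive (identity a e))

  am-gm : ∀ a b → 2 * (a * b) ≤ a * a + b * b
  am-gm a b with ≤-total a b
  ... | inj₁ a≤b = ordered a≤b
  ... | inj₂ b≤a = subst₂ _≤_ (cong (2 *_) (*-comm b a)) (+-comm (b * b) (a * a)) (ordered b≤a)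

δ : ∀ {n} → Fin n → Fin n → ℕ
δ i j = ι (does (i ≟ j))

sum-δ : ∀ {n} (i : Fin n) (f : Fin n → ℕ) → sum (λ j → δ i j * f j) ≡ f i
sum-δ {suc n} i f = begin
  sum (λ j → δ i j * f j)                                      ≡⟨ sum-remove i _ ⟩
  δ i i * f i + sum (λ j → δ i (punchIn i j) * f (punchIn i j)) ≡⟨ cong₂ _+_ (on-diagonal i) (sum-cong off-diagonal) ⟩
  f i + sum {n} (λ _ → 0)                                      ≡⟨ cong (f i +_) (trans (sum-const n 0) (*-zeroʳ n)) ⟩
  f i + 0                                                      ≡⟨ +-identityʳ (f i) ⟩
  f i                                                          ∎
  where
  open ≡-Reasoning
  on-diagonal : ∀ i → δ i i * f i ≡ f i
  on-diagonal i with i ≟ i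
  ... | yes _   = +-identityʳ (f i)
  ... | no  i≢i = contradiction refl i≢i

  off-diagonal : ∀ j → δ i (punchIn i j) * f (punchIn i j) ≡ 0
  off-diagonal j with i ≟ punchIn i j
  ... | yes i≡p = contradiction (sym i≡p) (punchInᵢ≢i i j)
  ... | no  _   = refl

sum-δ₁ : ∀ {n} (i : Fin n) → sum (δ i) ≡ 1
sum-δ₁ i = trans (sum-cong λ j → sym (*-identityʳ (δ i j))) (sum-δ i (λ _ → 1))

module _ {A : Set} (p : A → Bool) where
  count-∷ : ∀ x xs → count p (x ∷ xs) ≡ ι (p x) + count p xs
  count-∷ x xs with p x
  ... | true  = refl
  ... | false = refl

  count-++ : ∀ xs ys → count p (xs ++ ys) ≡ count p xs + count p ys
  count-++ []       ys = refl
  count-++ (x ∷ xs) ys = begin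
    count p (x ∷ xs ++ ys)                 ≡⟨ count-∷ x (xs ++ ys) ⟩
    ι (p x) + count p (xs ++ ys)           ≡⟨ cong (ι (p x) +_) (count-++ xs ys) ⟩
    ι (p x) + (count p xs + count p ys)    ≡⟨ +-assoc (ι (p x)) _ _ ⟨
    ι (p x) + count p xs + count p ys      ≡⟨ cong (_+ count p ys) (count-∷ x xs) ⟨
    count p (x ∷ xs) + count p ys          ∎
    where open ≡-Reasoning

  count-tabulate : ∀ {n} (f : Fin n → A) → count p (tabulate f) ≡ sum (λ i → ι (p (f i)))
  count-tabulate {zero}  f = sym (sum-zero _)
  count-tabulate {suc n} f = begin
    count p (tabulate f)                                 ≡⟨ count-∷ (f zero) (tabulate (f ∘ suc)) ⟩
    ι (p (f zero)) + count p (tabulate (f ∘ suc))        ≡⟨ cong (ι (p (f zero)) +_) (count-tabulate (f ∘ suc)) ⟩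
    ι (p (f zero)) + sum (λ i → ι (p (f (suc i))))       ≡⟨ sum-suc _ ⟨
    sum (λ i → ι (p (f i)))                              ∎
    where open ≡-Reasoning

count-map : ∀ {A B : Set} (p : B → Bool) (f : A → B) xs → count p (map f xs) ≡ count (p ∘ f) xs
count-map p f []       = refl
count-map p f (x ∷ xs) = begin
  count p (f x ∷ map f xs)             ≡⟨ count-∷ p (f x) (map f xs) ⟩
  ι (p (f x)) + count p (map f xs)     ≡⟨ cong (ι (p (f x)) +_) (count-map p f xs) ⟩
  ι (p (f x)) + count (p ∘ f) xs       ≡⟨ count-∷ (p ∘ f) x xs ⟨
  count (p ∘ f) (x ∷ xs)               ∎
  where open ≡-Reasoning

count-pairs : ∀ {m n} (p : Fin m × Fin n → Bool) →
              count p (cartesianProduct (allFin m) (allFin n)) ≡ sum₂ (λ i j → ι (p (i , j)))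
count-pairs {m} {n} p = go id
  where
  open ≡-Reasoning
  go : ∀ {k} (f : Fin k → Fin m) → count p (cartesianProduct (tabulate f) (allFin n)) ≡ sum₂ (λ i j → ι (p (f i , j)))
  go {zero}  f = sym (sum-zero _)
  go {suc k} f = begin
    count p (map (f zero ,_) (allFin n) ++ rest)            ≡⟨ count-++ p (map (f zero ,_) (allFin n)) rest ⟩
    count p (map (f zero ,_) (allFin n)) + count p rest     ≡⟨ cong₂ _+_ row (go (f ∘ suc)) ⟩
    sum (λ j → ι (p (f zero , j))) + sum₂ (λ i j → ι (p (f (suc i) , j)))  ≡⟨ sum-suc _ ⟨
    sum₂ (λ i j → ι (p (f i , j)))                          ∎
    where
    rest = cartesianProduct (tabulate (f ∘ suc)) (allFin n)
    row : count p (map (f zero ,_) (allFin n)) ≡ sum (λ j → ι (p (f zero , j)))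
    row = trans (count-map p (f zero ,_) (allFin n)) (count-tabulate (λ j → p (f zero , j)) id)

edge-irr₂₃ : ∀ {n} (G : ThreeGraph n) v x → edge G v x x ≡ false
edge-irr₂₃ G v x = trans (sym₁₂ G v x x) (trans (sym₂₃ G x v x) (irr G x v))

-- `deg` counts pairs in increasing order only; adding the reversed pairs gives a symmetric sum, the
-- diagonal being empty. All later counts use this doubled form.
handshake : ∀ {n} (G : ThreeGraph n) v → 2 * deg G v ≡ sum₂ (λ j k → ι (edge G v j k))
handshake {n} G v = begin
  2 * deg G v                                     ≡⟨ cong (deg G v +_) (+-identityʳ (deg G v)) ⟩
  deg G v + deg G v                               ≡⟨ cong₂ _+_ (count-pairs _) (trans (count-pairs _) (sum-comm below)) ⟩
  sum₂ below + sum₂ (λ j k → below k j)           ≡⟨ sum₂-+ below (λ j k → below k j) ⟨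
  sum₂ (λ j k → below j k + below k j)            ≡⟨ sum₂-cong orient ⟩
  sum₂ (λ j k → ι (edge G v j k))                 ∎
  where
  open ≡-Reasoning
  below : Fin n → Fin n → ℕ
  below j k = ι ((toℕ j <ᵇ toℕ k) ∧ edge G v j k)

  <ᵇ-true : ∀ {a b} → a < b → (a <ᵇ b) ≡ true
  <ᵇ-true {zero}  {suc b} _         = refl
  <ᵇ-true {suc a} {suc b} (s≤s a<b) = <ᵇ-true a<b

  <ᵇ-false : ∀ {a b} → b ≤ a → (a <ᵇ b) ≡ false
  <ᵇ-false {a}     {zero}  _         = refl
  <ᵇ-false {suc a} {suc b} (s≤s b≤a) = <ᵇ-false b≤a

  orient : ∀ j k → below j k + below k j ≡ ι (edge G v j k)
  orient j k with <-cmp (toℕ j) (toℕ k)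
  ... | tri< j<k _ _ rewrite <ᵇ-true j<k | <ᵇ-false (<⇒≤ j<k) = +-identityʳ _
  ... | tri> _ _ k<j rewrite <ᵇ-true k<j | <ᵇ-false (<⇒≤ k<j) = cong ι (sym₂₃ G v k j)
  ... | tri≈ _ j≡k _ with toℕ-injective j≡k
  ... | refl rewrite <ᵇ-false (≤-refl {toℕ j}) = cong ι (sym (edge-irr₂₃ G v j))

-- Sparse triples over a triangle-free graph

record TriangleFree (N : ℕ) : Set where
  field
    adj           : Fin N → Fin N → Bool
    adj-sym       : ∀ a b → adj a b ≡ adj b a
    adj-irr       : ∀ a → adj a a ≡ false
    triangle-free : ∀ a b c → adj a b ≡ true → adj a c ≡ true → adj b c ≡ true → ⊥

open TriangleFree

module _ {N : ℕ} (L : TriangleFree N) where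
  A : Fin N → Fin N → ℕ
  A a b = ι (adj L a b)

  degree : Fin N → ℕ
  degree a = sum (A a)

  sparse : Fin N → Fin N → Fin N → Bool
  sparse a b c = not (does (a ≟ b)) ∧ not (does (a ≟ c)) ∧ not (does (b ≟ c)) ∧ (A a b + A a c + A b c <ᵇ 2)

  A-sym : ∀ a b → A a b ≡ A b a
  A-sym a b = cong ι (adj-sym L a b)

  A-idem : ∀ a b → A a b * A a b ≡ A a b
  A-idem a b with adj L a b
  ... | true  = refl
  ... | false = refl

  -- A triple of distinct vertices is sparse or contains exactly one path with two edges; the δ terms
  -- account for the degenerate triples.
  sparse-pointwise : ∀ a b c →
    ι (sparse a b c) + (A a b * A a c + (A a b * A b c + (A a c * A c b + (δ a b + (δ a c + δ b c)))))
    ≡ 1 + (2 * (δ a b * δ a c) + (δ b c * A a b + (δ a c * A a b + δ a b * A a c)))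
  sparse-pointwise a b c with a ≟ b | a ≟ c | b ≟ c
  ... | yes refl | yes refl | yes _   rewrite adj-irr L a = refl
  ... | yes refl | yes a≡c  | no b≢c  = contradiction a≡c b≢c
  ... | yes refl | no a≢c   | yes b≡c = contradiction b≡c a≢c
  ... | yes refl | no _     | no _    rewrite adj-irr L a | adj-sym L c a | A-idem a c | +-identityʳ (A a c) = +-comm _ 1
  ... | no a≢b   | yes refl | yes b≡c = contradiction (sym b≡c) a≢b
  ... | no _     | yes refl | no _    rewrite adj-irr L a | adj-sym L b a | A-idem a b | *-zeroʳ (A a b) = trans (+-comm _ 1) (cong suc (sym (trans (+-identityʳ _) (+-identityʳ _))))
  ... | no _     | no _     | yes refl rewrite adj-irr L b | *-zeroʳ (A a b) | A-idem a b = trans (+-comm _ 1) (cong suc (sym (trans (+-identityʳ _) (+-identityʳ _))))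
  ... | no _     | no _     | no _ rewrite adj-sym L c b
    with adj L a b in ab | adj L a c in ac | adj L b c in bc
  ... | true  | true  | true  = ⊥-elim (triangle-free L a b c ab ac bc)
  ... | true  | true  | false = refl
  ... | true  | false | true  = refl
  ... | true  | false | false = refl
  ... | false | true  | true  = refl
  ... | false | true  | false = refl
  ... | false | false | true  = refl
  ... | false | false | false = refl

  neighbour-degrees : Fin N → ℕ
  neighbour-degrees a = sum (λ b → A a b * degree b)

  -- The sum of `sparse-pointwise` over ordered pairs. Paths centred at a contribute the square of
  -- its degree; those centred at b and those centred at c each contribute the neighbour degrees.
  -- Being an equality, the count serves both the upper bound and the construction.
  sparse-count : ∀ a →
    sum₂ (λ b c → ι (sparse a b c)) + (degree a * degree a + 2 * neighbour-degrees a + 3 * N)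
    ≡ 2 + N * N + 3 * degree a
  sparse-count a = begin
    Σsparse + (degree a * degree a + 2 * neighbour-degrees a + 3 * N)
      ≡⟨ arrangeˡ Σsparse (degree a * degree a) (neighbour-degrees a) N ⟩
    Σsparse + (degree a * degree a + (neighbour-degrees a + (neighbour-degrees a + (N + (N + N)))))
      ≡⟨ cong (Σsparse +_) (cong₂ _+_ cherries-at-a (cong₂ _+_ cherries-at-b (cong₂ _+_ cherries-at-c
           (cong₂ _+_ equal-ab (cong₂ _+_ equal-ac equal-bc))))) ⟨
    Σsparse + (sum₂ (λ b c → A a b * A a c) + (sum₂ (λ b c → A a b * A b c) + (sum₂ (λ b c → A a c * A c b)
      + (sum₂ {N} {N} (λ b _ → δ a b) + (sum₂ {N} {N} (λ _ c → δ a c) + sum₂ {N} {N} δ)))))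
      ≡⟨ split₅ _ _ _ _ _ _ _ ⟨
    sum₂ (λ b c → ι (sparse a b c) + (A a b * A a c + (A a b * A b c + (A a c * A c b + (δ a b + (δ a c + δ b c))))))
      ≡⟨ sum₂-cong (sparse-pointwise a) ⟩
    sum₂ (λ b c → 1 + (2 * (δ a b * δ a c) + (δ b c * A a b + (δ a c * A a b + δ a b * A a c))))
      ≡⟨ split₄ _ _ _ _ _ ⟩
    sum₂ {N} {N} (λ _ _ → 1) + (sum₂ (λ b c → 2 * (δ a b * δ a c)) + (sum₂ (λ b c → δ b c * A a b)
      + (sum₂ (λ b c → δ a c * A a b) + sum₂ (λ b c → δ a b * A a c))))
      ≡⟨ cong₂ _+_ (sum₂-const N N 1) (cong₂ _+_ all-equal (cong₂ _+_ diagonal-bc (cong₂ _+_ diagonal-ac diagonal-ab))) ⟩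
    N * (N * 1) + (2 + (degree a + (degree a + degree a)))
      ≡⟨ arrangeʳ N (degree a) ⟩
    2 + N * N + 3 * degree a ∎
    where
    open ≡-Reasoning
    Σsparse = sum₂ (λ b c → ι (sparse a b c))

    arrangeˡ : ∀ s q r n → s + (q + 2 * r + 3 * n) ≡ s + (q + (r + (r + (n + (n + n)))))
    arrangeˡ = solve-∀
    arrangeʳ : ∀ n d → n * (n * 1) + (2 + (d + (d + d))) ≡ 2 + n * n + 3 * d
    arrangeʳ = solve-∀

    split₂ : (f g h : Fin N → Fin N → ℕ) → sum₂ (λ b c → f b c + (g b c + h b c)) ≡ sum₂ f + (sum₂ g + sum₂ h)
    split₂ f g h = trans (sum₂-+ f _) (cong (sum₂ f +_) (sum₂-+ g h))
    split₄ : (f g h i j : Fin N → Fin N → ℕ) →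
      sum₂ (λ b c → f b c + (g b c + (h b c + (i b c + j b c)))) ≡ sum₂ f + (sum₂ g + (sum₂ h + (sum₂ i + sum₂ j)))
    split₄ f g h i j = trans (split₂ f g _) (cong (λ z → sum₂ f + (sum₂ g + z)) (split₂ h i j))
    split₅ : (f g h i j k l : Fin N → Fin N → ℕ) →
      sum₂ (λ b c → f b c + (g b c + (h b c + (i b c + (j b c + (k b c + l b c))))))
      ≡ sum₂ f + (sum₂ g + (sum₂ h + (sum₂ i + (sum₂ j + (sum₂ k + sum₂ l)))))
    split₅ f g h i j k l = trans (split₂ f g _) (cong (λ z → sum₂ f + (sum₂ g + z)) (split₄ h i j k l))

    cherries-at-a : sum₂ (λ b c → A a b * A a c) ≡ degree a * degree a
    cherries-at-a = trans (sum-cong λ b → sum-*ˡ (A a b) (A a)) (sum-*ʳ (degree a) (A a))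
    cherries-at-b : sum₂ (λ b c → A a b * A b c) ≡ neighbour-degrees a
    cherries-at-b = sum-cong λ b → sum-*ˡ (A a b) (A b)
    cherries-at-c : sum₂ (λ b c → A a c * A c b) ≡ neighbour-degrees a
    cherries-at-c = trans (sum-comm _) cherries-at-b

    equal-ab : sum₂ {N} {N} (λ b _ → δ a b) ≡ N
    equal-ab = begin
      sum₂ {N} {N} (λ b _ → δ a b) ≡⟨ sum-comm _ ⟩
      sum {N} (λ _ → sum (δ a))    ≡⟨ sum-const N _ ⟩
      N * sum (δ a)                ≡⟨ cong (N *_) (sum-δ₁ a) ⟩
      N * 1                        ≡⟨ *-identityʳ N ⟩
      N                            ∎
    equal-ac : sum₂ {N} {N} (λ _ c → δ a c) ≡ N
    equal-ac = trans (sum-comm _) equal-ab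
    equal-bc : sum₂ {N} {N} δ ≡ N
    equal-bc = trans (sum-cong sum-δ₁) (trans (sum-const N 1) (*-identityʳ N))

    diagonal-bc : sum₂ (λ b c → δ b c * A a b) ≡ degree a
    diagonal-bc = sum-cong λ b → sum-δ b (λ _ → A a b)
    diagonal-ac : sum₂ (λ b c → δ a c * A a b) ≡ degree a
    diagonal-ac = sum-cong λ b → sum-δ a (λ _ → A a b)
    diagonal-ab : sum₂ (λ b c → δ a b * A a c) ≡ degree a
    diagonal-ab = trans (sum-comm _) diagonal-ac
    all-equal : sum₂ (λ b c → 2 * (δ a b * δ a c)) ≡ 2
    all-equal = begin
      sum₂ (λ b c → 2 * (δ a b * δ a c)) ≡⟨ sum-cong (λ b → trans (sum-*ˡ 2 _) (cong (2 *_) (sum-*ˡ (δ a b) (δ a)))) ⟩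
      sum (λ b → 2 * (δ a b * sum (δ a))) ≡⟨ sum-*ˡ 2 _ ⟩
      2 * sum (λ b → δ a b * sum (δ a))   ≡⟨ cong (2 *_) (sum-δ a _) ⟩
      2 * sum (δ a)                       ≡⟨ cong (2 *_) (sum-δ₁ a) ⟩
      2                                   ∎

  -- Each b occurs as a neighbour of exactly `degree b` vertices, so its degree is summed that many
  -- times.
  degree-sum : sum neighbour-degrees ≡ sum (λ a → degree a * degree a)
  degree-sum = begin
    sum₂ (λ a b → A a b * degree b)         ≡⟨ sum-comm _ ⟩
    sum₂ (λ b a → A a b * degree b)         ≡⟨ sum₂-cong (λ b a → cong (_* degree b) (A-sym a b)) ⟩
    sum₂ (λ b a → A b a * degree b)         ≡⟨ sum-cong (λ b → sum-*ʳ (degree b) (A b)) ⟩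
    sum (λ b → degree b * degree b)         ∎
    where open ≡-Reasoning

-- Coverings and existence of c₁

true≢false : ∀ {b} → b ≡ true → b ≡ false → ⊥
true≢false refl ()

-- The two ways in which the vertex v can lie in a copy of K₄⁻: as its centre, or as a leaf,
-- in which case the centre is b.
Covered : ∀ {n} → ThreeGraph n → Fin n → Set
Covered G v = ∃[ a ] ∃[ b ] ∃[ c ]
  (edge G v a b ≡ true × edge G v b c ≡ true × (edge G v a c ≡ true ⊎ edge G a b c ≡ true))

copy⇒covered : ∀ {n} (G : ThreeGraph n) {v} → CopyContaining K4minus G v → Covered G v
copy⇒covered G (φ , _ , hom , zero , refl) =
  φ (suc zero) , φ (suc (suc zero)) , φ (suc (suc (suc zero))) , hom _ _ _ refl , hom _ _ _ refl , inj₁ (hom _ _ _ refl)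
copy⇒covered G (φ , _ , hom , suc zero , refl) =
  φ (suc (suc zero)) , φ zero , φ (suc (suc (suc zero))) , hom _ _ _ refl , hom _ _ _ refl , inj₂ (hom _ _ _ refl)
copy⇒covered G (φ , _ , hom , suc (suc zero) , refl) =
  φ (suc zero) , φ zero , φ (suc (suc (suc zero))) , hom _ _ _ refl , hom _ _ _ refl , inj₂ (hom _ _ _ refl)
copy⇒covered G (φ , _ , hom , suc (suc (suc zero)) , refl) =
  φ (suc zero) , φ zero , φ (suc (suc zero)) , hom _ _ _ refl , hom _ _ _ refl , inj₂ (hom _ _ _ refl)

module _ {n} (G : ThreeGraph n) {o x y z : Fin n}
         (oxy : edge G o x y ≡ true) (oxz : edge G o x z ≡ true) (oyz : edge G o y z ≡ true) where

  star : Fin 4 → Fin n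
  star zero                   = o
  star (suc zero)             = x
  star (suc (suc zero))       = y
  star (suc (suc (suc zero))) = z

  star-edge : ∀ j k → j ≢ k → edge G o (star (suc j)) (star (suc k)) ≡ true
  star-edge zero             zero             j≢k = contradiction refl j≢k
  star-edge zero             (suc zero)       j≢k = oxy
  star-edge zero             (suc (suc zero)) j≢k = oxz
  star-edge (suc zero)       zero             j≢k = trans (sym₂₃ G _ _ _) oxy
  star-edge (suc zero)       (suc zero)       j≢k = contradiction refl j≢k
  star-edge (suc zero)       (suc (suc zero)) j≢k = oyz
  star-edge (suc (suc zero)) zero             j≢k = trans (sym₂₃ G _ _ _) oxz
  star-edge (suc (suc zero)) (suc zero)       j≢k = trans (sym₂₃ G _ _ _) oyz
  star-edge (suc (suc zero)) (suc (suc zero)) j≢k = contradiction refl j≢k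

  star-hom : ∀ i j k → edge K4minus i j k ≡ true → edge G (star i) (star j) (star k) ≡ true
  star-hom zero    (suc j) (suc k) h = star-edge j k λ { refl → true≢false h (edge-irr₂₃ K4minus zero (suc j)) }
  star-hom (suc i) zero    (suc k) h =
    trans (sym₁₂ G _ _ _) (star-hom zero (suc i) (suc k) (trans (sym₁₂ K4minus zero (suc i) (suc k)) h))
  star-hom (suc i) (suc j) zero    h =
    trans (sym₂₃ G _ _ _) (trans (sym₁₂ G _ _ _) (star-hom zero (suc i) (suc j)
      (trans (sym₁₂ K4minus zero (suc i) (suc j)) (trans (sym₂₃ K4minus (suc i) zero (suc j)) h))))
  -- No index is the centre 0, so the last conjunct of `K4m-edge` computes to `false`.
  star-hom (suc i) (suc j) (suc k) h = ⊥-elim (no-centre (not (toℕ i ≡ᵇ toℕ j)) (not (toℕ j ≡ᵇ toℕ k)) (not (toℕ i ≡ᵇ toℕ k)) h)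
    where
    no-centre : ∀ b₁ b₂ b₃ → (b₁ ∧ b₂ ∧ b₃ ∧ false) ≡ true → ⊥
    no-centre true  true  true  ()
    no-centre true  true  false ()
    no-centre true  false _     ()
    no-centre false _     _     ()

  centre≢leaf : ∀ j → o ≢ star (suc j)
  centre≢leaf zero             refl = true≢false oxy (irr G _ _)
  centre≢leaf (suc zero)       refl = true≢false oyz (irr G _ _)
  centre≢leaf (suc (suc zero)) refl = true≢false (trans (sym₂₃ G _ _ _) oxz) (irr G _ _)

  -- Any two of the four vertices lie in a common edge through `o`, and an edge has no repeated
  -- vertex.
  star-injective : ∀ {i j} → star i ≡ star j → i ≡ j
  star-injective {zero}  {zero}  _  = refl
  star-injective {zero}  {suc j} eq = contradiction eq (centre≢leaf j)
  star-injective {suc i} {zero}  eq = contradiction (sym eq) (centre≢leaf i)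
  star-injective {suc i} {suc j} eq with i ≟ j
  ... | yes i≡j = cong suc i≡j
  ... | no  i≢j = ⊥-elim (true≢false (trans (cong (edge G o _) eq) (star-edge i j i≢j)) (edge-irr₂₃ G o _))

  star-copy : ∀ i → CopyContaining K4minus G (star i)
  star-copy i = star , star-injective , star-hom , i , refl

covered⇒copy : ∀ {n} (G : ThreeGraph n) {v} → Covered G v → CopyContaining K4minus G v
covered⇒copy G (a , b , c , vab , vbc , inj₁ vac) = star-copy G vab vac vbc zero
covered⇒copy G (a , b , c , vab , vbc , inj₂ abc) =
  star-copy G (trans (sym₁₂ G _ _ _) (trans (sym₂₃ G _ _ _) vab)) (trans (sym₁₂ G _ _ _) vbc) (trans (sym₁₂ G _ _ _) abc) (suc zero)

-- `Covered` replaces the quantifier over maps from four points by a search for three vertices. The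
-- resulting decision procedure is what turns the failure of a covering into an actual uncovered
-- vertex.
covered? : ∀ {n} (G : ThreeGraph n) v → Dec (Covered G v)
covered? G v = any? λ a → any? λ b → any? λ c →
  (edge G v a b ≟ᵇ true) ×-dec (edge G v b c ≟ᵇ true) ×-dec ((edge G v a c ≟ᵇ true) ⊎-dec (edge G a b c ≟ᵇ true))

copy? : ∀ {n} (G : ThreeGraph n) v → Dec (CopyContaining K4minus G v)
copy? G v = map′ (covered⇒copy G) (copy⇒covered G) (covered? G v)

hasCovering? : ∀ {n} (G : ThreeGraph n) → Dec (HasCovering K4minus G)
hasCovering? G = all? (copy? G)

uncovered-vertex : ∀ {n} (G : ThreeGraph n) → ¬ HasCovering K4minus G → ∃[ v ] ¬ Covered G v
uncovered-vertex {n} G ¬cov with ¬∀⟶∃¬ n _ (copy? G) ¬cov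
... | v , ¬copy = v , ¬copy ∘ covered⇒copy G

minDegIs? : ∀ {n} (G : ThreeGraph n) d → Dec (MinDegIs G d)
minDegIs? G d = all? (λ v → d ≤? deg G v) ×-dec any? (λ v → deg G v ≟ⁿ d)

argmin : ∀ {n} (f : Fin (suc n) → ℕ) → ∃[ i ] ∀ j → f i ≤ f j
argmin {zero}  f = zero , λ { zero → ≤-refl }
argmin {suc n} f with argmin (f ∘ suc)
... | i , min with ≤-total (f zero) (f (suc i))
... | inj₁ f₀≤ = zero , λ { zero → ≤-refl ; (suc j) → ≤-trans f₀≤ (min j) }
... | inj₂ ≤f₀ = suc i , λ { zero → ≤f₀ ; (suc j) → min j }

minDeg : ∀ {n} (G : ThreeGraph (suc n)) → ∃[ d ] MinDegIs G d
minDeg G with argmin (deg G)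
... | v , min = deg G v , min , v , refl

-- `IsC1` compares c with exact minimum degrees only, so a lower bound on all degrees is passed
-- through the true minimum.
minDeg-≤ : ∀ {n c d} {G : ThreeGraph (suc n)} → IsC1 (suc n) K4minus c → ¬ HasCovering K4minus G → (∀ v → d ≤ deg G v) → d ≤ c
minDeg-≤ {G = G} (_ , max) ¬cov d≤deg with minDeg G
... | δ , δ-min@(_ , v , deg≡δ) = ≤-trans (subst (_ ≤_) deg≡δ (d≤deg v)) (max G δ ¬cov δ-min)

module _ {n} {G H : ThreeGraph n} (G≗H : ∀ x y z → edge G x y z ≡ edge H x y z) where
  -- A graph recovered from its table agrees with the original only pointwise, so every predicate to
  -- be searched must respect pointwise equality of edges.
  deg-cong : ∀ v → deg G v ≡ deg H v
  deg-cong v = *-cancelˡ-≡ _ _ 2 (trans (handshake G v) (trans (sum₂-cong λ j k → cong ι (G≗H v j k)) (sym (handshake H v))))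

  covering-cong : HasCovering K4minus G → HasCovering K4minus H
  covering-cong cov v with cov v
  ... | φ , inj , hom , i , φi≡v = φ , inj , (λ x y z h → trans (sym (G≗H _ _ _)) (hom x y z h)) , i , φi≡v

  minDegIs-cong : ∀ {d} → MinDegIs G d → MinDegIs H d
  minDegIs-cong (min , v , deg≡) = (λ v → subst (_ ≤_) (deg-cong v) (min v)) , v , trans (sym (deg-cong v)) deg≡

-- Exhaustive search over 3-graphs and existence of the maximum.

module _ {n : ℕ} where
  -- The truth table of `edge` is stored as a subset of n³ cells, so a search over subsets reaches
  -- every 3-graph.
  decode : Subset (n * (n * n)) → Fin n → Fin n → Fin n → Bool
  decode s x y z = Vec.lookup s (combine x (combine y z))

  encode : (Fin n → Fin n → Fin n → Bool) → Subset (n * (n * n))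
  encode e = Vec.tabulate λ i → uncurry (λ x yz → uncurry (e x) (remQuot n yz)) (remQuot (n * n) i)

  decode-encode : ∀ e x y z → decode (encode e) x y z ≡ e x y z
  decode-encode e x y z = begin
    Vec.lookup (encode e) (combine x (combine y z))                    ≡⟨ lookup∘tabulate _ (combine x (combine y z)) ⟩
    uncurry (λ x′ yz → uncurry (e x′) (remQuot n yz)) (remQuot (n * n) (combine x (combine y z)))
                                                                   ≡⟨ cong (uncurry λ x′ yz → uncurry (e x′) (remQuot n yz)) (remQuot-combine x (combine y z)) ⟩
    uncurry (e x) (remQuot n (combine y z))                        ≡⟨ cong (uncurry (e x)) (remQuot-combine y z) ⟩
    e x y z                                                        ∎
    where open ≡-Reasoning

  IsThreeGraph : (Fin n → Fin n → Fin n → Bool) → Set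
  IsThreeGraph e = (∀ x y z → e x y z ≡ e y x z) × (∀ x y z → e x y z ≡ e x z y) × (∀ x z → e x x z ≡ false)

  isThreeGraph? : ∀ e → Dec (IsThreeGraph e)
  isThreeGraph? e =
    all? (λ x → all? λ y → all? λ z → e x y z ≟ᵇ e y x z)
    ×-dec all? (λ x → all? λ y → all? λ z → e x y z ≟ᵇ e x z y)
    ×-dec all? (λ x → all? λ z → e x x z ≟ᵇ false)

  toGraph : ∀ e → IsThreeGraph e → ThreeGraph n
  toGraph e (s₁₂ , s₂₃ , ir) = record { edge = e ; sym₁₂ = s₁₂ ; sym₂₃ = s₂₃ ; irr = ir }

  anyGraph? : {P : ThreeGraph n → Set} → (∀ G → Dec (P G)) →
              (∀ {G H} → (∀ x y z → edge G x y z ≡ edge H x y z) → P G → P H) → Dec (Σ (ThreeGraph n) P)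
  anyGraph? {P} P? resp = map′ to from (anySubset? λ s → search (decode s))
    where
    search : ∀ e → Dec (Σ (IsThreeGraph e) λ g → P (toGraph e g))
    search e with isThreeGraph? e
    ... | no ¬g = no (¬g ∘ proj₁)
    ... | yes g with P? (toGraph e g)
    ... | yes p = yes (g , p)
    -- The two graphs have the same `edge` and differ only in the proofs of their axioms.
    ... | no ¬p = no λ { (_ , p) → ¬p (resp (λ _ _ _ → refl) p) }

    to : (∃[ s ] Σ (IsThreeGraph (decode s)) λ g → P (toGraph (decode s) g)) → Σ (ThreeGraph n) P
    to (s , g , p) = toGraph (decode s) g , p

    from : Σ (ThreeGraph n) P → ∃[ s ] Σ (IsThreeGraph (decode s)) λ g → P (toGraph (decode s) g)
    from (G , p) = encode (edge G) , graph , resp (λ x y z → sym (decode-encode (edge G) x y z)) p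
      where
      eq = decode-encode (edge G)
      graph : IsThreeGraph (decode (encode (edge G)))
      graph = (λ x y z → trans (eq x y z) (trans (sym₁₂ G x y z) (sym (eq y x z))))
            , (λ x y z → trans (eq x y z) (trans (sym₂₃ G x y z) (sym (eq x z y))))
            , (λ x z → trans (eq x x z) (irr G x z))

maximum : {P : ℕ → Set} → (∀ k → Dec (P k)) → ∀ b → (∀ k → P k → k ≤ b) → ∃ P → ∃[ c ] (P c × ∀ k → P k → k ≤ c)
maximum P? zero bound (k , pk) with bound k pk
... | z≤n = zero , pk , bound
maximum {P} P? (suc b) bound p with P? (suc b)
... | yes pb = suc b , pb , bound
... | no ¬pb = maximum P? b below p
  where
  below : ∀ k → P k → k ≤ b
  below k pk with m≤n⇒m<n∨m≡n (bound k pk)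
  ... | inj₁ (s≤s k≤b) = k≤b
  ... | inj₂ refl      = contradiction pk ¬pb

deg-≤ : ∀ {n} (G : ThreeGraph n) v → deg G v ≤ length (cartesianProduct (allFin n) (allFin n))
deg-≤ {n} G v = length-filter (T? ∘ _) (cartesianProduct (allFin n) (allFin n))

c1-exists : ∀ {n} (G : ThreeGraph (suc n)) → ¬ HasCovering K4minus G → ∃[ c ] IsC1 (suc n) K4minus c
c1-exists {n} G ¬cov with maximum attained? pairs attained-≤ (proj₁ (minDeg G) , G , ¬cov , proj₂ (minDeg G))
  where
  Attained : ℕ → Set
  Attained d = Σ (ThreeGraph (suc n)) λ H → ¬ HasCovering K4minus H × MinDegIs H d

  attained? : ∀ d → Dec (Attained d)
  attained? d = anyGraph? (λ H → ¬? (hasCovering? H) ×-dec minDegIs? H d)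
    λ { {H} {K} H≗K (¬cov , min) → ¬cov ∘ covering-cong {G = K} {H = H} (λ x y z → sym (H≗K x y z)) , minDegIs-cong {G = H} {H = K} H≗K min }

  pairs : ℕ
  pairs = length (cartesianProduct (allFin (suc n)) (allFin (suc n)))

  attained-≤ : ∀ d → Attained d → d ≤ pairs
  attained-≤ d (H , _ , _ , v , refl) = deg-≤ H v
... | c , attained , max = c , attained , λ H d ¬cov min → max d (H , ¬cov , min)

-- The upper bound

module _ {N} (G : ThreeGraph (suc N)) (x : Fin (suc N)) where
  private
    p : Fin N → Fin (suc N)
    p = punchIn x

  deg-link : 2 * deg G x ≡ sum₂ (λ a b → ι (edge G x (p a) (p b)))
  deg-link = begin
    2 * deg G x                                                        ≡⟨ handshake G x ⟩
    sum₂ (λ j k → ι (edge G x j k))                                    ≡⟨ sum-remove x _ ⟩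
    sum (λ k → ι (edge G x x k)) + sum (λ a → sum (λ k → ι (edge G x (p a) k)))
      ≡⟨ cong₂ _+_ (trans (sum-cong λ k → cong ι (irr G x k)) (trans (sum-const (suc N) 0) (*-zeroʳ (suc N)))) (sum-cong row) ⟩
    sum₂ (λ a b → ι (edge G x (p a) (p b)))                            ∎
    where
    open ≡-Reasoning
    row : ∀ a → sum (λ k → ι (edge G x (p a) k)) ≡ sum (λ b → ι (edge G x (p a) (p b)))
    row a = trans (sum-remove x _) (cong (_+ sum (λ b → ι (edge G x (p a) (p b)))) (cong ι (trans (sym₂₃ G x (p a) x) (irr G x (p a)))))

  -- Edges at `p a` are split by whether they contain x; those that do occur twice, with x as the
  -- first or as the second entry of the ordered pair.
  deg-off-link : ∀ a → 2 * deg G (p a) ≡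
    2 * sum (λ b → ι (edge G x (p a) (p b))) + sum₂ (λ b c → ι (edge G (p a) (p b) (p c)))
  deg-off-link a = begin
    2 * deg G (p a)                                                    ≡⟨ handshake G (p a) ⟩
    sum₂ (λ j k → ι (edge G (p a) j k))                                ≡⟨ sum-remove x _ ⟩
    sum (λ k → ι (edge G (p a) x k)) + sum (λ b → sum (λ k → ι (edge G (p a) (p b) k)))
      ≡⟨ cong₂ _+_ row-x (trans (sum-cong row) (sum-+ _ _)) ⟩
    D + (D + E)                                                        ≡⟨ arrange D E ⟩
    2 * D + E                                                          ∎
    where
    open ≡-Reasoning
    D = sum (λ b → ι (edge G x (p a) (p b)))
    E = sum₂ (λ b c → ι (edge G (p a) (p b) (p c)))
    arrange : ∀ d e → d + (d + e) ≡ 2 * d + e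
    arrange = solve-∀
    row-x : sum (λ k → ι (edge G (p a) x k)) ≡ D
    row-x = trans (sum-remove x _) (cong₂ _+_ (cong ι (edge-irr₂₃ G (p a) x)) (sum-cong λ b → cong ι (sym₁₂ G (p a) x (p b))))
    row : ∀ b → sum (λ k → ι (edge G (p a) (p b) k)) ≡ ι (edge G x (p a) (p b)) + sum (λ c → ι (edge G (p a) (p b) (p c)))
    row b = trans (sum-remove x _) (cong (_+ sum (λ c → ι (edge G (p a) (p b) (p c))))
      (cong ι (trans (sym₂₃ G (p a) (p b) x) (sym₁₂ G (p a) x (p b)))))

module _ {N} (G : ThreeGraph (suc N)) (x : Fin (suc N)) (¬covered : ¬ Covered G x) where
  private
    p : Fin N → Fin (suc N)
    p = punchIn x

  -- A triangle of the link would be a copy centred at x.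
  link : TriangleFree N
  link = record
    { adj           = λ a b → edge G x (p a) (p b)
    ; adj-sym       = λ a b → sym₂₃ G x (p a) (p b)
    ; adj-irr       = λ a → edge-irr₂₃ G x (p a)
    ; triangle-free = λ a b c ab ac bc → ¬covered (p a , p b , p c , ab , bc , inj₁ ac)
    }

  -- If an edge abc contained two link edges, their common vertex would be the centre of a copy with
  -- leaves x and the other two vertices. The excluded cases differ in which of a, b, c is that
  -- centre.
  off-link-sparse : ∀ a b c → ι (edge G (p a) (p b) (p c)) ≤ ι (sparse link a b c)
  off-link-sparse a b c with edge G (p a) (p b) (p c) in abc
  ... | false = z≤n
  ... | true with a ≟ b | a ≟ c | b ≟ c
  ... | yes refl | _        | _        = ⊥-elim (true≢false abc (irr G (p a) (p c)))
  ... | no _     | yes refl | _        = ⊥-elim (true≢false (trans (sym₂₃ G _ _ _) abc) (irr G (p a) (p b)))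
  ... | no _     | no _     | yes refl = ⊥-elim (true≢false abc (edge-irr₂₃ G (p a) (p b)))
  ... | no _     | no _     | no _
    with edge G x (p a) (p b) in ab | edge G x (p a) (p c) in ac | edge G x (p b) (p c) in bc
  ... | true  | _     | true  = ⊥-elim (¬covered (p a , p b , p c , ab , bc , inj₂ abc))
  ... | true  | true  | false = ⊥-elim (¬covered (p b , p a , p c , trans (sym₂₃ G _ _ _) ab , ac , inj₂ (trans (sym₁₂ G _ _ _) abc)))
  ... | false | true  | true  = ⊥-elim (¬covered (p a , p c , p b , ac , trans (sym₂₃ G _ _ _) bc , inj₂ (trans (sym₂₃ G _ _ _) abc)))
  ... | true  | false | false = ≤-refl
  ... | false | true  | false = ≤-refl
  ... | false | false | true  = ≤-refl
  ... | false | false | false = ≤-refl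

  module _ {d} (d≤deg : ∀ v → d ≤ deg G v) where
    private
      D : Fin N → ℕ
      D = degree link
      S = sum D
      Q = sum (λ a → D a * D a)

    link-local : ∀ a → 2 * d + (D a * D a + 2 * neighbour-degrees link a + 3 * N) ≤ 2 + N * N + 5 * D a
    link-local a = begin
      2 * d + rest                                                   ≤⟨ +-monoˡ-≤ rest (*-monoʳ-≤ 2 (d≤deg (p a))) ⟩
      2 * deg G (p a) + rest                                         ≡⟨ cong (_+ rest) (deg-off-link G x a) ⟩
      2 * D a + sum₂ (λ b c → ι (edge G (p a) (p b) (p c))) + rest   ≤⟨ +-monoˡ-≤ rest (+-monoʳ-≤ (2 * D a) (sum₂-mono-≤ (off-link-sparse a))) ⟩
      2 * D a + sum₂ (λ b c → ι (sparse link a b c)) + rest          ≡⟨ +-assoc (2 * D a) _ rest ⟩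
      2 * D a + (sum₂ (λ b c → ι (sparse link a b c)) + rest)        ≡⟨ cong (2 * D a +_) (sparse-count link a) ⟩
      2 * D a + (2 + N * N + 3 * D a)                                ≡⟨ arrange (D a) (2 + N * N) ⟩
      2 + N * N + 5 * D a                                            ∎
      where
      open ≤-Reasoning
      rest = D a * D a + 2 * neighbour-degrees link a + 3 * N
      arrange : ∀ e r → 2 * e + (r + 3 * e) ≡ r + 5 * e
      arrange = solve-∀

    -- The coefficient 3 is 1 + 2: the squared degrees sum to Q, and by `degree-sum` the doubled
    -- neighbour degrees sum to 2Q. The extra factor N lets Cauchy-Schwarz be applied without
    -- division.
    link-global : N * N * (2 * d) + 3 * (S * S) + 3 * N * (N * N) ≤ (2 + N * N) * (N * N) + 5 * N * S
    link-global = begin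
      N * N * (2 * d) + 3 * (S * S) + 3 * N * (N * N)      ≤⟨ +-monoˡ-≤ _ (+-monoʳ-≤ (N * N * (2 * d)) (*-monoʳ-≤ 3 (cauchy-schwarz D))) ⟩
      N * N * (2 * d) + 3 * (N * Q) + 3 * N * (N * N)      ≡⟨ arrangeˡ N d Q ⟩
      N * (N * (2 * d) + (Q + 2 * Q + N * (3 * N)))        ≡⟨ cong (N *_) summed ⟨
      N * sum (λ a → 2 * d + (D a * D a + 2 * neighbour-degrees link a + 3 * N)) ≤⟨ *-monoʳ-≤ N (sum-mono-≤ link-local) ⟩
      N * sum (λ a → 2 + N * N + 5 * D a)                  ≡⟨ cong (N *_) (trans (sum-+ _ _) (cong₂ _+_ (sum-const N _) (sum-*ˡ 5 D))) ⟩
      N * (N * (2 + N * N) + 5 * S)                        ≡⟨ arrangeʳ N S ⟩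
      (2 + N * N) * (N * N) + 5 * N * S                    ∎
      where
      open ≤-Reasoning
      arrangeˡ : ∀ n e q → n * n * (2 * e) + 3 * (n * q) + 3 * n * (n * n) ≡ n * (n * (2 * e) + (q + 2 * q + n * (3 * n)))
      arrangeˡ = solve-∀
      arrangeʳ : ∀ n s → n * (n * (2 + n * n) + 5 * s) ≡ (2 + n * n) * (n * n) + 5 * n * s
      arrangeʳ = solve-∀
      summed : sum (λ a → 2 * d + (D a * D a + 2 * neighbour-degrees link a + 3 * N)) ≡ N * (2 * d) + (Q + 2 * Q + N * (3 * N))
      summed = trans (sum-+ _ _) (cong₂ _+_ (sum-const N _) (trans (sum-+ _ _) (cong₂ _+_ (trans (sum-+ _ _)
        (cong (Q +_) (trans (sum-*ˡ 2 _) (cong (2 *_) (degree-sum link))))) (sum-const N _))))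

    -- The second use of the minimum degree: the degree of x is the number of link edges. This bound
    -- is what later eliminates `S` from `link-global`.
    link-size : 2 * d ≤ S
    link-size = ≤-trans (*-monoʳ-≤ 2 (d≤deg x)) (≤-reflexive (deg-link G x))

-- The concave quadratic 5NS − 3S² decreases on S ≥ 5N/6, so that for s ≥ N the variable S ≥ s may be
-- replaced by s; for s < N the conclusion holds trivially.
replace-by-lower-bound : ∀ k s S → let N = 2 + k in s ≤ S →
  N * N * s + 3 * (S * S) ≤ N * N * ((1 + k) * k) + 5 * N * S →
  N * N * s + 3 * (s * s) ≤ N * N * ((1 + k) * k) + 5 * N * s
replace-by-lower-bound k s S s≤S h with m≤n⇒∃[o]m+o≡n s≤S
... | e , refl with ≤-<-connex (2 + k) s
... | inj₁ N≤s = +-cancelʳ-≤ (6 * (s * e) + 3 * (e * e)) _ _ (begin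
    N * N * s + 3 * (s * s) + (6 * (s * e) + 3 * (e * e)) ≡⟨ expand (N * N * s) s e ⟨
    N * N * s + 3 * ((s + e) * (s + e))                             ≤⟨ h ⟩
    M + 5 * N * (s + e)                                                       ≡⟨ distribute M N s e ⟩
    M + 5 * N * s + 5 * (N * e)                                             ≤⟨ +-monoʳ-≤ (M + 5 * N * s) small ⟩
    M + 5 * N * s + (6 * (s * e) + 3 * (e * e))                       ∎)
  where
  open ≤-Reasoning
  N = 2 + k
  M = N * N * ((1 + k) * k)
  expand : ∀ c s e → c + 3 * ((s + e) * (s + e)) ≡ c + 3 * (s * s) + (6 * (s * e) + 3 * (e * e))
  expand = solve-∀
  distribute : ∀ m n s e → m + 5 * n * (s + e) ≡ m + 5 * n * s + 5 * (n * e)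
  distribute = solve-∀
  small : 5 * (N * e) ≤ 6 * (s * e) + 3 * (e * e)
  small = ≤-trans (*-mono-≤ (n≤1+n 5) (*-monoˡ-≤ e N≤s)) (m≤m+n _ _)
... | inj₂ s<N = begin
    N * N * s + 3 * (s * s)                                      ≤⟨ +-monoʳ-≤ (N * N * s) (*-monoʳ-≤ 3 (*-monoˡ-≤ s (<⇒≤ s<N))) ⟩
    N * N * s + 3 * (N * s)                                      ≡⟨ split k s ⟩
    N * (k * s) + 5 * N * s                                      ≤⟨ +-monoˡ-≤ (5 * N * s) bound ⟩
    N * N * ((1 + k) * k) + 5 * N * s                            ∎
  where
  open ≤-Reasoning
  N = 2 + k
  split : ∀ k s → (2 + k) * (2 + k) * s + 3 * ((2 + k) * s) ≡ (2 + k) * (k * s) + 5 * (2 + k) * s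
  split = solve-∀
  bound : N * (k * s) ≤ N * N * ((1 + k) * k)
  bound = begin
    N * (k * s)           ≤⟨ *-monoʳ-≤ N (*-monoʳ-≤ k (≤-pred s<N)) ⟩
    N * (k * (1 + k))     ≡⟨ cong (N *_) (*-comm k (1 + k)) ⟩
    N * ((1 + k) * k)     ≤⟨ *-monoˡ-≤ ((1 + k) * k) (m≤m*n N N) ⟩
    N * N * ((1 + k) * k) ∎

degree-bound : ∀ k (G : ThreeGraph (3 + k)) {d} → ¬ HasCovering K4minus G → (∀ v → d ≤ deg G v) → let N = 2 + k in
  N * N * (2 * d) + 3 * (2 * d * (2 * d)) ≤ N * N * ((1 + k) * k) + 5 * N * (2 * d)
degree-bound k G {d} ¬cov d≤deg with uncovered-vertex G ¬cov
... | x , ¬covered = replace-by-lower-bound k (2 * d) S (link-size G x ¬covered d≤deg)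
  (+-cancelʳ-≤ (3 * N * (N * N)) _ _ (≤-trans (link-global G x ¬covered d≤deg) (≤-reflexive (arrange k S))))
  where
  N = 2 + k
  S = sum (degree (link G x ¬covered))
  arrange : ∀ k s → let n = 2 + k in (2 + n * n) * (n * n) + 5 * n * s ≡ n * n * ((1 + k) * k) + 5 * n * s + 3 * n * (n * n)
  arrange = solve-∀

-- The lower bound

∧-exchange : ∀ x y {u v} → u ≡ v → (x ∧ y ∧ u) ≡ (y ∧ x ∧ v)
∧-exchange true  y     refl = refl
∧-exchange false true  refl = refl
∧-exchange false false refl = refl

does-≟-sym : ∀ {n} (a b : Fin n) → does (a ≟ b) ≡ does (b ≟ a)
does-≟-sym a b with a ≟ b | b ≟ a
... | yes _   | yes _   = refl
... | no  _   | no  _   = refl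
... | yes a≡b | no  b≢a = contradiction (sym a≡b) b≢a
... | no  a≢b | yes b≡a = contradiction (sym b≡a) a≢b

module _ {N} (L : TriangleFree N) where

  sparse-sym₁₂ : ∀ a b c → sparse L a b c ≡ sparse L b a c
  sparse-sym₁₂ a b c rewrite does-≟-sym b a | A-sym L b a =
    cong (not (does (a ≟ b)) ∧_) (∧-exchange (not (does (a ≟ c))) (not (does (b ≟ c))) (cong (_<ᵇ 2) (swap-last (A L a b) (A L a c) (A L b c))))
    where
    swap-last : ∀ i j k → i + j + k ≡ i + k + j
    swap-last = solve-∀

  sparse-sym₂₃ : ∀ a b c → sparse L a b c ≡ sparse L a c b
  sparse-sym₂₃ a b c rewrite does-≟-sym c b | A-sym L c b =
    ∧-exchange (not (does (a ≟ b))) (not (does (a ≟ c)))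
      (cong (λ s → not (does (b ≟ c)) ∧ (s <ᵇ 2)) (cong (_+ A L b c) (+-comm (A L a b) (A L a c))))

  sparse-irr : ∀ a c → sparse L a a c ≡ false
  sparse-irr a c with a ≟ a
  ... | yes _   = refl
  ... | no  a≢a = contradiction refl a≢a

  sparse-no-path : ∀ a b c → sparse L a b c ≡ true → adj L a b ≡ true → adj L b c ≡ true → ⊥
  sparse-no-path a b c h ab bc with a ≟ b | a ≟ c | b ≟ c
  ... | no _ | no _ | no _ rewrite ab | bc with adj L a c | h
  ... | true  | ()
  ... | false | ()

  cone-edge : Fin (suc N) → Fin (suc N) → Fin (suc N) → Bool
  cone-edge zero    (suc b) (suc c) = adj L b c
  cone-edge (suc a) zero    (suc c) = adj L a c
  cone-edge (suc a) (suc b) zero    = adj L a b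
  cone-edge (suc a) (suc b) (suc c) = sparse L a b c
  cone-edge zero    zero    _       = false
  cone-edge zero    (suc _) zero    = false
  cone-edge (suc _) zero    zero    = false

  -- The densest 3-graph in which the vertex 0 is uncovered and has link L.
  cone : ThreeGraph (suc N)
  cone = record { edge = cone-edge ; sym₁₂ = s₁₂ ; sym₂₃ = s₂₃ ; irr = ir }
    where
    s₁₂ : ∀ x y z → cone-edge x y z ≡ cone-edge y x z
    s₁₂ zero    zero    z       = refl
    s₁₂ zero    (suc b) zero    = refl
    s₁₂ zero    (suc b) (suc c) = refl
    s₁₂ (suc a) zero    zero    = refl
    s₁₂ (suc a) zero    (suc c) = refl
    s₁₂ (suc a) (suc b) zero    = adj-sym L a b
    s₁₂ (suc a) (suc b) (suc c) = sparse-sym₁₂ a b c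
    s₂₃ : ∀ x y z → cone-edge x y z ≡ cone-edge x z y
    s₂₃ zero    zero    zero    = refl
    s₂₃ zero    zero    (suc c) = refl
    s₂₃ zero    (suc b) zero    = refl
    s₂₃ zero    (suc b) (suc c) = adj-sym L b c
    s₂₃ (suc a) zero    zero    = refl
    s₂₃ (suc a) zero    (suc c) = refl
    s₂₃ (suc a) (suc b) zero    = refl
    s₂₃ (suc a) (suc b) (suc c) = sparse-sym₂₃ a b c
    ir : ∀ x z → cone-edge x x z ≡ false
    ir zero    z       = refl
    ir (suc a) zero    = adj-irr L a
    ir (suc a) (suc c) = sparse-irr a c

  apex-uncovered : ¬ Covered cone zero
  apex-uncovered (suc a , suc b , suc c , ab , bc , inj₁ ac)  = triangle-free L a b c ab ac bc
  apex-uncovered (suc a , suc b , suc c , ab , bc , inj₂ abc) = sparse-no-path a b c abc ab bc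

  cone-uncovered : ¬ HasCovering K4minus cone
  cone-uncovered cov = apex-uncovered (copy⇒covered cone (cov zero))

-- Regular bipartite graphs and their cones.

-- Moving the window one place drops f(i) and gains f(i + m), which are equal by periodicity. Hence
-- all rows of the circulant have the same sum.
window-sum : ∀ m (f : ℕ → ℕ) → (∀ i → f (i + m) ≡ f i) → ∀ i → sum {m} (λ j → f (i + toℕ j)) ≡ sum {m} (λ j → f (toℕ j))
window-sum m f periodic zero    = refl
window-sum m f periodic (suc i) = trans (+-cancelˡ-≡ (f i) _ _ (begin
  f i + sum {m} (λ j → f (suc i + toℕ j))              ≡⟨ cong₂ _+_ (cong f (+-identityʳ i)) (sum-cong {m} λ j → cong f (+-suc i (toℕ j))) ⟨
  f (i + 0) + sum {m} (λ j → f (i + suc (toℕ j)))      ≡⟨ sum-suc {m} (λ j → f (i + toℕ j)) ⟨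
  sum {suc m} (λ j → f (i + toℕ j))                    ≡⟨ sum-last {m} (λ j → f (i + j)) ⟩
  sum {m} (λ j → f (i + toℕ j)) + f (i + m)            ≡⟨ cong (sum {m} (λ j → f (i + toℕ j)) +_) (periodic i) ⟩
  sum {m} (λ j → f (i + toℕ j)) + f i                  ≡⟨ +-comm _ (f i) ⟩
  f i + sum {m} (λ j → f (i + toℕ j))                  ∎)) (window-sum m f periodic i)
  where open ≡-Reasoning

count-below : ∀ {m d} → d ≤ m → sum {m} (λ j → ι (toℕ j <ᵇ d)) ≡ d
count-below {m}     {zero}  _         = trans (sum-const m 0) (*-zeroʳ m)
count-below {suc m} {suc d} (s≤s d≤m) = trans (sum-suc {m} _) (cong suc (count-below d≤m))

-- A d-regular bipartite graph on two classes of m vertices, with r isolated vertices added.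
module Bipartite (m r d : ℕ) .{{_ : NonZero m}} (d≤m : d ≤ m) where
  N : ℕ
  N = m + (m + r)

  V : Set
  V = Fin m ⊎ (Fin m ⊎ Fin r)

  part : Fin N → V
  part a = map₂ (splitAt m) (splitAt m a)

  -- Depends only on i + j, so that rows and columns have the same sums.
  circulant : Fin m → Fin m → Bool
  circulant i j = (toℕ i + toℕ j) % m <ᵇ d

  joined : V → V → Bool
  joined (inj₁ i)        (inj₂ (inj₁ j)) = circulant i j
  joined (inj₂ (inj₁ j)) (inj₁ i)        = circulant j i
  joined _               _               = false

  graph : TriangleFree N
  graph = record
    { adj           = λ a b → joined (part a) (part b)
    ; adj-sym       = λ a b → joined-sym (part a) (part b)
    ; adj-irr       = λ a → joined-irr (part a)
    ; triangle-free = λ a b c → no-triangle (part a) (part b) (part c)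
    }
    where
    joined-sym : ∀ u v → joined u v ≡ joined v u
    joined-sym (inj₁ i)        (inj₁ j)        = refl
    joined-sym (inj₁ i)        (inj₂ (inj₁ j)) = cong (λ s → s % m <ᵇ d) (+-comm (toℕ i) (toℕ j))
    joined-sym (inj₁ i)        (inj₂ (inj₂ j)) = refl
    joined-sym (inj₂ (inj₁ i)) (inj₁ j)        = cong (λ s → s % m <ᵇ d) (+-comm (toℕ i) (toℕ j))
    joined-sym (inj₂ (inj₁ i)) (inj₂ (inj₁ j)) = refl
    joined-sym (inj₂ (inj₁ i)) (inj₂ (inj₂ j)) = refl
    joined-sym (inj₂ (inj₂ i)) (inj₁ j)        = refl
    joined-sym (inj₂ (inj₂ i)) (inj₂ (inj₁ j)) = refl
    joined-sym (inj₂ (inj₂ i)) (inj₂ (inj₂ j)) = refl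

    joined-irr : ∀ u → joined u u ≡ false
    joined-irr (inj₁ i)        = refl
    joined-irr (inj₂ (inj₁ i)) = refl
    joined-irr (inj₂ (inj₂ i)) = refl

    no-triangle : ∀ u v w → joined u v ≡ true → joined u w ≡ true → joined v w ≡ true → ⊥
    no-triangle (inj₁ _)        (inj₂ (inj₁ _)) (inj₂ (inj₁ _)) _ _ ()
    no-triangle (inj₂ (inj₁ _)) (inj₁ _)        (inj₁ _)        _ _ ()

  sum-part : (f : V → ℕ) → sum (f ∘ part) ≡
    sum (λ i → f (inj₁ i)) + (sum (λ j → f (inj₂ (inj₁ j))) + sum (λ l → f (inj₂ (inj₂ l))))
  sum-part f = trans (sum-↑ m (f ∘ part)) (cong₂ _+_
    (sum-cong λ i → cong (f ∘ map₂ (splitAt m)) (splitAt-↑ˡ m i (m + r)))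
    (trans (sum-cong λ j → cong (f ∘ map₂ (splitAt m)) (splitAt-↑ʳ m (m + r) j))
      (trans (sum-↑ m (f ∘ inj₂ ∘ splitAt m)) (cong₂ _+_
        (sum-cong λ j → cong (f ∘ inj₂) (splitAt-↑ˡ m j r))
        (sum-cong λ l → cong (f ∘ inj₂) (splitAt-↑ʳ m r l))))))

  circulant-row : ∀ i → sum (λ j → ι (circulant i j)) ≡ d
  circulant-row i = begin
    sum {m} (λ j → ι ((toℕ i + toℕ j) % m <ᵇ d)) ≡⟨ window-sum m (λ s → ι (s % m <ᵇ d)) (λ s → cong (λ t → ι (t <ᵇ d)) ([m+n]%n≡m%n s m)) (toℕ i) ⟩
    sum {m} (λ j → ι (toℕ j % m <ᵇ d))           ≡⟨ sum-cong {m} (λ j → cong (λ t → ι (t <ᵇ d)) (m<n⇒m%n≡m (toℕ<n j))) ⟩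
    sum {m} (λ j → ι (toℕ j <ᵇ d))               ≡⟨ count-below d≤m ⟩
    d                                            ∎
    where open ≡-Reasoning

  degreeV : V → ℕ
  degreeV (inj₁ _)        = d
  degreeV (inj₂ (inj₁ _)) = d
  degreeV (inj₂ (inj₂ _)) = 0

  sum-0 : ∀ n → sum {n} (λ _ → 0) ≡ 0
  sum-0 n = trans (sum-const n 0) (*-zeroʳ n)

  degree-part : ∀ a → degree graph a ≡ degreeV (part a)
  degree-part a = trans (sum-part (λ v → ι (joined (part a) v))) (by-part (part a))
    where
    by-part : ∀ u → sum (λ i → ι (joined u (inj₁ i))) + (sum (λ j → ι (joined u (inj₂ (inj₁ j)))) + sum (λ l → ι (joined u (inj₂ (inj₂ l)))))
                    ≡ degreeV u
    by-part (inj₁ i)        = trans (cong₂ _+_ (sum-0 m) (cong₂ _+_ (circulant-row i) (sum-0 r))) (+-identityʳ d)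
    by-part (inj₂ (inj₁ i)) = trans (cong₂ _+_ (circulant-row i) (cong₂ _+_ (sum-0 m) (sum-0 r))) (+-identityʳ d)
    by-part (inj₂ (inj₂ i)) = cong₂ _+_ (sum-0 m) (cong₂ _+_ (sum-0 m) (sum-0 r))

  degreeV-≤ : ∀ u → degreeV u ≤ d
  degreeV-≤ (inj₁ _)        = ≤-refl
  degreeV-≤ (inj₂ (inj₁ _)) = ≤-refl
  degreeV-≤ (inj₂ (inj₂ _)) = z≤n

  neighbour-degrees-≤ : ∀ a → neighbour-degrees graph a ≤ degreeV (part a) * d
  neighbour-degrees-≤ a = begin
    sum (λ b → A graph a b * degree graph b) ≤⟨ sum-mono-≤ (λ b → *-monoʳ-≤ (A graph a b) (≤-trans (≤-reflexive (degree-part b)) (degreeV-≤ (part b)))) ⟩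
    sum (λ b → A graph a b * d)              ≡⟨ sum-*ʳ d (A graph a) ⟩
    degree graph a * d                       ≡⟨ cong (_* d) (degree-part a) ⟩
    degreeV (part a) * d                     ∎
    where open ≤-Reasoning

  degree-total : sum (degree graph) ≡ 2 * (m * d)
  degree-total = begin
    sum (degree graph)                               ≡⟨ sum-cong degree-part ⟩
    sum (degreeV ∘ part)                             ≡⟨ sum-part degreeV ⟩
    sum {m} (λ _ → d) + (sum {m} (λ _ → d) + sum {r} (λ _ → 0)) ≡⟨ cong₂ _+_ (sum-const m d) (cong₂ _+_ (sum-const m d) (sum-0 r)) ⟩
    m * d + (m * d + 0)                              ∎
    where open ≡-Reasoning

  -- The apex has degree exactly md. The first hypothesis is `Quad N d` and handles the vertices of
  -- the two classes; the second handles isolated vertices and is guarded by `Fin r`, so that it is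
  -- demanded only if there are any.
  cone-min-degree : 3 * (d * d) + N * d + 3 * N ≤ 2 + N * N + 5 * d →
                    (Fin r → 2 * (m * d) + 3 * N ≤ 2 + N * N) →
                    ∀ v → m * d ≤ deg (cone graph) v
  cone-min-degree regular isolated zero    = *-cancelˡ-≤ 2 (≤-reflexive (sym (trans (deg-link (cone graph) zero) degree-total)))
  cone-min-degree regular isolated (suc a) = *-cancelˡ-≤ 2 (+-cancelʳ-≤ rest _ _ (begin
    2 * (m * d) + rest                            ≤⟨ +-monoʳ-≤ (2 * (m * d)) (+-monoˡ-≤ (3 * N) (+-mono-≤ (≤-reflexive (cong₂ _*_ (degree-part a) (degree-part a)))
                                                       (*-monoʳ-≤ 2 (neighbour-degrees-≤ a)))) ⟩
    2 * (m * d) + (D * D + 2 * (D * d) + 3 * N)   ≤⟨ by-part (part a) ⟩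
    2 + N * N + 5 * D                             ≡⟨ arrange D (2 + N * N) ⟨
    2 * D + (2 + N * N + 3 * D)                   ≡⟨ cong (λ e → 2 * e + (2 + N * N + 3 * e)) (degree-part a) ⟨
    2 * degree graph a + (2 + N * N + 3 * degree graph a)
                                                  ≡⟨ cong (2 * degree graph a +_) (sparse-count graph a) ⟨
    2 * degree graph a + (Σsparse + rest)         ≡⟨ +-assoc (2 * degree graph a) Σsparse rest ⟨
    2 * degree graph a + Σsparse + rest           ≡⟨ cong (_+ rest) (deg-off-link (cone graph) zero a) ⟨
    2 * deg (cone graph) (suc a) + rest           ∎))
    where
    open ≤-Reasoning
    D = degreeV (part a)
    Σsparse = sum₂ (λ b c → ι (sparse graph a b c))
    rest = degree graph a * degree graph a + 2 * neighbour-degrees graph a + 3 * N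
    arrange : ∀ e s → 2 * e + (s + 3 * e) ≡ s + 5 * e
    arrange = solve-∀
    both-classes : ∀ m r d → (m + (m + r)) * d ≡ 2 * (m * d) + r * d
    both-classes = solve-∀
    collect : ∀ x d n → x + (d * d + 2 * (d * d) + 3 * n) ≡ 3 * (d * d) + x + 3 * n
    collect = solve-∀
    class : 2 * (m * d) + (d * d + 2 * (d * d) + 3 * N) ≤ 2 + N * N + 5 * d
    class = begin
      2 * (m * d) + (d * d + 2 * (d * d) + 3 * N) ≡⟨ collect (2 * (m * d)) d N ⟩
      3 * (d * d) + 2 * (m * d) + 3 * N           ≤⟨ +-monoˡ-≤ (3 * N) (+-monoʳ-≤ (3 * (d * d)) (≤-trans (m≤m+n (2 * (m * d)) (r * d)) (≤-reflexive (sym (both-classes m r d))))) ⟩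
      3 * (d * d) + N * d + 3 * N                 ≤⟨ regular ⟩
      2 + N * N + 5 * d                           ∎
    by-part : ∀ u → 2 * (m * d) + (degreeV u * degreeV u + 2 * (degreeV u * d) + 3 * N) ≤ 2 + N * N + 5 * degreeV u
    by-part (inj₁ _)        = class
    by-part (inj₂ (inj₁ _)) = class
    by-part (inj₂ (inj₂ l)) = ≤-trans (isolated l) (≤-reflexive (sym (+-identityʳ _)))

-- The threshold

open import Data.Integer as ℤ using (ℤ; +_; -[1+_]; +≤+; -≤+)
import Data.Integer.Properties as ℤ

two-choose : ∀ k → 2 * (suc k C 2) ≡ suc k * k
two-choose zero    = refl
two-choose (suc k) = begin
  2 * ((2 + k) C 2)              ≡⟨ cong (2 *_) (nCk+nC[k+1]≡[n+1]C[k+1] (suc k) 1) ⟨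
  2 * (suc k C 1 + suc k C 2)    ≡⟨ *-distribˡ-+ 2 (suc k C 1) (suc k C 2) ⟩
  2 * (suc k C 1) + 2 * (suc k C 2) ≡⟨ cong₂ (λ x y → 2 * x + y) (nC1≡n (suc k)) (two-choose k) ⟩
  2 * suc k + suc k * k          ≡⟨ arrange k ⟩
  (2 + k) * suc k                ∎
  where
  open ≡-Reasoning
  arrange : ∀ k → 2 * (1 + k) + (1 + k) * k ≡ (2 + k) * (1 + k)
  arrange = solve-∀

halve : ∀ k → ∃[ m ] ∃[ r ] (r ≤ 1 × 2 + k ≡ suc m + (suc m + r))
halve zero          = 0 , 0 , z≤n , refl
halve (suc zero)    = 0 , 1 , s≤s z≤n , refl
halve (suc (suc k)) with halve k
... | m , r , r≤1 , eq = suc m , r , r≤1 , trans (cong (λ s → 2 + s) eq) (sym (cong suc (+-suc (suc m) (suc m + r))))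

quad? : ∀ N d → Dec (Quad N d)
quad? N d = _ ≤? _

quad-zero : ∀ k → Quad (2 + k) 0
quad-zero k = ≤-trans (m≤m+n _ ((1 + k) * k)) (≤-reflexive (identity k))
  where
  identity : ∀ k → 3 * (0 * 0) + (2 + k) * 0 + 3 * (2 + k) + (1 + k) * k ≡ 2 + (2 + k) * (2 + k) + 5 * 0
  identity = solve-∀

-- d⋆ is about 0.43 n, below half of N, so an admissible degree fits into a class. For d = m + 2 + e
-- the violation of `Quad` is a polynomial in m and e with nonnegative coefficients, computed
-- separately for r = 0 and r = 1.
quad⇒≤ : ∀ m r d → r ≤ 1 → Quad (suc m + (suc m + r)) d → d ≤ suc m
quad⇒≤ m r d r≤1 h with ≤-<-connex d (suc m)
... | inj₁ d≤m = d≤m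
... | inj₂ m<d with m≤n⇒∃[o]m+o≡n m<d | r≤1
... | e , refl | z≤n = contradiction h (<⇒≱ (≤-trans (m≤m+n _ _) (≤-reflexive (identity m e))))
  where
  identity : ∀ m e → let N = 1 + m + (1 + m + 0) ; d = 2 + m + e in
    1 + (2 + N * N + 5 * d) + (5 + m * m + 11 * m + 9 * e + 8 * (m * e) + 3 * (e * e)) ≡ 3 * (d * d) + N * d + 3 * N
  identity = solve-∀
... | e , refl | s≤s z≤n = contradiction h (<⇒≱ (≤-trans (m≤m+n _ _) (≤-reflexive (identity m e))))
  where
  identity : ∀ m e → let N = 1 + m + (1 + m + 1) ; d = 2 + m + e in
    1 + (2 + N * N + 5 * d) + (5 + m * m + 8 * m + 10 * e + 8 * (m * e) + 3 * (e * e)) ≡ 3 * (d * d) + N * d + 3 * N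
  identity = solve-∀

-- An isolated vertex of L forms a sparse triple with every pair of other vertices, so twice its
-- degree is N² - 3N + 2, which is at least 2(m + 1)².
isolated-bound : ∀ m d → d ≤ suc m → let N = suc m + (suc m + 1) in 2 * (suc m * d) + 3 * N ≤ 2 + N * N
isolated-bound m d d≤m = begin
  2 * (suc m * d) + 3 * N                              ≤⟨ +-monoˡ-≤ (3 * N) (*-monoʳ-≤ 2 (*-monoʳ-≤ (suc m) d≤m)) ⟩
  2 * (suc m * suc m) + 3 * N                          ≤⟨ m≤m+n _ (2 * (m * suc m)) ⟩
  2 * (suc m * suc m) + 3 * N + 2 * (m * suc m)        ≡⟨ identity m ⟩
  2 + N * N                                            ∎
  where
  open ≤-Reasoning
  N = suc m + (suc m + 1)
  identity : ∀ m → let N = 1 + m + (1 + m + 1) in 2 * ((1 + m) * (1 + m)) + 3 * N + 2 * (m * (1 + m)) ≡ 2 + N * N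
  identity = solve-∀

last-true : {P : ℕ → Set} → (∀ d → Dec (P d)) → P 0 → ∀ b → ¬ P b → ∃[ d ] (P d × ¬ P (suc d))
last-true P? p₀ zero    ¬pb = contradiction p₀ ¬pb
last-true P? p₀ (suc b) ¬pb with P? b
... | yes pb = b , pb , ¬pb
... | no ¬p  = last-true P? p₀ b ¬p

c1-upper : ∀ k {c} → IsC1 (3 + k) K4minus c → Quad² k c
c1-upper k ((G , ¬cov , min , _) , _) = degree-bound k G ¬cov min

c1-lower : ∀ N m r d {c} → r ≤ 1 → N ≡ suc m + (suc m + r) → Quad N d → IsC1 (suc N) K4minus c → suc m * d ≤ c
c1-lower N m r d r≤1 refl h c1 = minDeg-≤ {G = cone B.graph} c1 (cone-uncovered B.graph) (B.cone-min-degree h (isolated r≤1))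
  where
  d≤m = quad⇒≤ m r d r≤1 h
  module B = Bipartite (suc m) r d d≤m
  isolated : ∀ {r} → r ≤ 1 → Fin r → let N = suc m + (suc m + r) in 2 * (suc m * d) + 3 * N ≤ 2 + N * N
  isolated (s≤s z≤n) _ = isolated-bound m d d≤m

c1-value : ∀ N m r → N ≡ suc m + (suc m + r) → ∃[ c ] IsC1 (suc N) K4minus c
c1-value N m r refl = c1-exists (cone B.graph) (cone-uncovered B.graph)
  -- The empty link, d = 0, already leaves the apex uncovered, which is enough to start the search
  -- for the maximum.
  where module B = Bipartite (suc m) r 0 z≤n

odd-case : ∀ k → (3 + k) % 2 ≡ 1 → ∃[ c ] (IsC1 (3 + k) K4minus c
  × (∀ a → IsFloorDStar (3 + k) a → (+ (3 + k) ℤ.- + 1) ℤ.* a ℤ.≤ + 2 ℤ.* + c)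
  × (∀ a → IsFloorHalfDStar (3 + k) a → + c ℤ.≤ a))
odd-case k odd with halve k
-- For odd n the number N is even, so no isolated vertex occurs and each class has exactly (n - 1)/2
-- vertices.
... | m , suc zero , s≤s z≤n , eq = contradiction (trans (sym odd) even) λ ()
  where
  arrange : ∀ m → 1 + (1 + m + (1 + m + 1)) ≡ 0 + (2 + m) * 2
  arrange = solve-∀
  even : (3 + k) % 2 ≡ 0
  even = trans (cong (_% 2) (trans (cong suc eq) (arrange m))) ([m+kn]%n≡m%n 0 (2 + m) 2)
... | m , zero , r≤1 , eq with c1-value (2 + k) m 0 eq
... | c , c1 = c , c1 , lower , λ a → floor-half-d⋆-≥ (3 + k) (Quad²⇒≤half-d⋆ k c (c1-upper k c1))
  where
  2c≥0 : + 0 ℤ.≤ + 2 ℤ.* + c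
  2c≥0 = 0≤-* (0≤+ 2) (0≤+ c)

  nonpositive : ∀ {a} → a ℤ.≤ + 0 → + (2 + k) ℤ.* a ℤ.≤ + 2 ℤ.* + c
  nonpositive a≤0 = ℤ.≤-trans (ℤ.*-monoˡ-≤-nonNeg (+ (2 + k)) a≤0) (subst (ℤ._≤ _) (sym (ℤ.*-zeroʳ (+ (2 + k)))) 2c≥0)

  lower : ∀ a → IsFloorDStar (3 + k) a → + (2 + k) ℤ.* a ℤ.≤ + 2 ℤ.* + c
  lower -[1+ _ ]   _         = nonpositive -≤+
  lower (+ zero)   _         = nonpositive ℤ.≤-refl
  lower (+ suc d) (a≤d⋆ , _) = subst₂ ℤ._≤_ (ℤ.pos-* (2 + k) (suc d)) (ℤ.pos-* 2 c) (+≤+ (begin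
    (2 + k) * suc d                 ≡⟨ cong (_* suc d) eq ⟩
    (suc m + (suc m + 0)) * suc d   ≡⟨ *-assoc 2 (suc m) (suc d) ⟩
    2 * (suc m * suc d)             ≤⟨ *-monoʳ-≤ 2 (c1-lower (2 + k) m 0 (suc d) z≤n eq (≤d⋆⇒Quad k d a≤d⋆) c1) ⟩
    2 * c                           ∎))
    where open ≤-Reasoning

limit-case : ∀ j k c → let q = suc j in 4 * q ≤ k → IsC1 (3 + k) K4minus c → CloseToLimit c ((2 + k) C 2) q
limit-case j k c 4q≤k c1 = subst₃ Close (sym (cast (con 6 ⊠ var 0F ⊠ var 1F) (c ∷ q ∷ []))) (sym (ℤ.pos-* q b)) (sym (ℤ.pos-* 6 b))
  (upper-bound , lower-bound)
  where
  q b : ℕ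
  q = suc j
  b = (2 + k) C 2

  Close : ℤ → ℤ → ℤ → Set
  Close x y z = ((a ℤ.< + 0) ⊎ (a ℤ.* a ℤ.< + 13 ℤ.* y ℤ.* y)) × ((+ 0 ℤ.< a′) × (+ 13 ℤ.* y ℤ.* y ℤ.< a′ ℤ.* a′))
    where
    a a′ : ℤ
    a = x ℤ.+ y ℤ.- z
    a′ = x ℤ.+ y ℤ.+ z

  subst₃ : ∀ (P : ℤ → ℤ → ℤ → Set) {x x′ y y′ z z′} → x ≡ x′ → y ≡ y′ → z ≡ z′ → P x y z → P x′ y′ z′
  subst₃ P refl refl refl p = p

  0<b : + 0 ℤ.< + b
  0<b = ℤ.*-cancelˡ-<-nonNeg (+ 2) (subst (+ 0 ℤ.<_) (trans (sym (cong +_ (two-choose (suc k)))) (ℤ.pos-* 2 b)) (0<+suc _))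

  open Limit (+ k) (+ c) (+ b) (+ q) (0≤+ k) (0≤+ c) 0<b (0<+suc j)
    (trans (sym (ℤ.pos-* 2 b)) (trans (cong +_ (two-choose (suc k))) (ℤ.pos-* (2 + k) (1 + k))))

  upper-bound = upper (quad²-to-ℤ k c (c1-upper k c1)) (subst (ℤ._≤ + (1 + k)) (ℤ.pos-* 2 q)
    (+≤+ (≤-trans (*-monoˡ-≤ q (s≤s (s≤s (z≤n {2})))) (m≤n⇒m≤1+n 4q≤k))))

  lower-bound : (+ 0 ℤ.< + 6 ℤ.* + c ℤ.* + q ℤ.+ + q ℤ.* + b ℤ.+ + 6 ℤ.* + b)
              × (+ 13 ℤ.* (+ q ℤ.* + b) ℤ.* (+ q ℤ.* + b) ℤ.< _)
  lower-bound with halve k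
  -- `Quad` holds at 0 and fails beyond the class size; a switch point d between them takes the role
  -- of the floor of d⋆.
  ... | m , r , r≤1 , eq with last-true (quad? (2 + k)) (quad-zero k) (2 + m)
                               (λ h → 1+n≰n (quad⇒≤ m r (2 + m) r≤1 (subst (λ N → Quad N (2 + m)) eq h)))
  ... | d , quad-d , ¬quad-suc = lower (+ d) (0≤+ d)
    (subst₂ ℤ._≤_ (ℤ.pos-* (1 + k) d) (ℤ.pos-* 2 c) (+≤+ (begin
      -- The two classes contain all N vertices except at most one, hence at least 1 + k = N - 1.
      (1 + k) * d            ≤⟨ *-monoˡ-≤ d (≤-pred (≤-trans (≤-reflexive eq) (≤-trans (+-monoʳ-≤ (suc m) (+-monoʳ-≤ (suc m) r≤1)) (≤-reflexive (arrange m))))) ⟩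
      2 * suc m * d          ≡⟨ *-assoc 2 (suc m) d ⟩
      2 * (suc m * d)        ≤⟨ *-monoʳ-≤ 2 (c1-lower (2 + k) m r d r≤1 eq quad-d c1) ⟩
      2 * c                  ∎)))
    (¬quad-to-ℤ (2 + k) (suc d) ¬quad-suc)
    (subst (ℤ._≤ + (2 + k)) (ℤ.pos-* 4 q) (+≤+ (≤-trans 4q≤k (m≤n+m k 2))))
    where
    open ≤-Reasoning
    arrange : ∀ m → 1 + m + (1 + m + 1) ≡ 1 + 2 * (1 + m)
    arrange = solve-∀

theorem1p1 : ((n : ℕ) → 3 ≤ n → n % 2 ≡ 1 →
    ∃[ c ] (IsC1 n K4minus c
    × (∀ a → IsFloorDStar n a → (+ n ℤ.- + 1) ℤ.* a ℤ.≤ + 2 ℤ.* + c)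
    × (∀ k → IsFloorHalfDStar n k → + c ℤ.≤ k)))
    × (∀ m → ∃[ N ] ∀ n → N ≤ n → ∀ c → IsC1 n K4minus c →
    CloseToLimit c ((n Data.Nat.∸ 1) C 2) (suc m))
-- With n = 3 + k and q = `suc m`, the threshold 3 + 4q says 4q ≤ k, the condition under which the
-- error terms are absorbed.
theorem1p1 = (λ { (suc (suc (suc k))) _ odd → odd-case k odd ; 0 () ; 1 (s≤s ()) ; 2 (s≤s (s≤s ())) }) , λ m → 3 + 4 * suc m , λ
  { (suc (suc (suc k))) (s≤s (s≤s (s≤s 4q≤k))) c c1 → limit-case m k c 4q≤k c1 }
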